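{- Let $\mathbb T=(T,\mu,\eta)$ be a monad (possibly a strong one) on a category $\mathcal C$ with finite products and weak pullbacks. Then the total component of $\mathcal D(\Psi(\mathbb T))$, i.e. the monad on $\mathrm{Diff}(\Psi_{\mathcal C})$ which is the upper component of the monad $\mathcal D(\Psi(\mathbb T))$ on the fibration $\partial_{\Psi_{\mathcal C}}$, is a differential extension of $\mathbb T$ along $\Psi_{\mathcal C}$.
   Context: **2-categories.** Fibrations are cloven Grothendieck fibrations; a bifibration is a functor that is both a (cloven) fibration and (cloven) opfibration, and for $u:q(A)\to J$ the chosen cocartesian lifting is $\mathrm{cc}_{u,A}:A\to u_!A$. $\mathbf{Fib}$: objects fibrations; a 1-arrow $F:p\to q$ from $p:\mathcal E\to\mathcal B$ to $q:\mathcal F\to\mathcal C$ is a pair of functors $(F_b:\mathcal B\to\mathcal C,F_t:\mathcal E\to\mathcal F)$ with $F_bp=qF_t$; a 2-arrow $F\Rightarrow G$ is a pair of natural transformations $(\phi_b:F_b\Rightarrow G_b,\phi_t:F_t\Rightarrow G_t)$ with $\phi_bp=q\phi_t$; compositions are componentwise. $\mathbf{biFib}_c$ is the sub-2-category of bifibrations with finite products in the base, 1-arrows with $F_t$ preserving cocartesian arrows, and all 2-arrows. A monad on a fibration $p$ is a monad in $\mathbf{Fib}$: a 1-arrow $T$ on $p$ and 2-arrows $\mu,\eta$ such that $(T_b,\mu_b,\eta_b)$ and $(T_t,\mu_t,\eta_t)$ are monads; then $(T_t,\mu_t,\eta_t)$ is called a lifting of $(T_b,\mu_b,\eta_b)$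 along $p$. **Differential relations.** For a fibration $p:\mathcal E\to\mathcal B$ with $\mathcal B$ having finite products, $\mathrm{Diff}(p)$ has objects $X=(|X|,[X],\delta_X)$ with $|X|,[X]\in\mathcal B$ and $\delta_X\in\mathcal E_{|X|\times[X]\times|X|}$; arrows $f:X\to Y$ are triples $(|f|:|X|\to|Y|,\ Df:|X|\times[X]\to|Y|\times[Y],\ \bar f:\delta_X\to\delta_Y)$ with $\pi_1\circ Df=|f|\circ\pi_1$ and $\bar f$ above $Df\times|f|$; composition is componentwise. Put $DX=|X|\times[X]$, $\nabla X=|X|\times[X]\times|X|$. The functor $\partial_p:\mathrm{Diff}(p)\to\mathcal B$, $X\mapsto|X|$, is a fibration. A differential extension of a monad $\mathbb T$ on $\mathcal B$ along $p$ is a lifting of $\mathbb T$ along the fibration $\partial_p$. **Weak subobjects.** For a category $\mathcal C$ with weak pullbacks, $\mathrm{WS}(\mathcal C)$ has objects $(I,[\alpha])$ with $\alpha:X\to I$ an arrow of $\mathcal C$ and $[\alpha]$ its class for the equivalence induced by the preorder $\alpha\le\beta$ iff $\alpha=\beta\circ f$ for some $f$; an arrow $(I,[\alpha])\to(J,[\beta])$ is an arrow $f:I\to J$ of $\mathcal C$ with $f\circ\alpha\le\beta$. $\Psi_{\mathcal C}:\mathrm{WS}(\mathcal C)\to\mathcal C$, $(I,[\alpha])\mapsto I$, $f\mapsto f$, is a bifibration. For a functor $F:\mathcal C\to\mathcal C'$ set $\Psi(F)=(F,\tilde F)$ with $\tilde F(I,[\alpha])=(FI,[F\alpha])$, $\tilde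 Ff=Ff$; for a natural transformation $\phi$ set $\Psi(\phi)=(\phi,\tilde\phi)$ with $\tilde\phi_{(I,[\alpha])}=\phi_I$. For a monad $\mathbb T=(T,\mu,\eta)$, $\Psi(\mathbb T)=(\Psi(T),\Psi(\mu),\Psi(\eta))$ is a monad on $\Psi_{\mathcal C}$ in $\mathbf{biFib}_c$. **The construction $\mathcal D$.** Let $p:\mathcal E\to\mathcal B$, $q:\mathcal F\to\mathcal C$ be bifibrations with finite products in the base. For a functor $K:\mathcal B\to\mathcal C$ and $X\in\mathrm{Diff}(p)$ let $s^K_X=\langle K\pi_1,K\langle\pi_1,\pi_2\rangle,K\pi_3\rangle:K(\nabla X)\to K|X|\times K(DX)\times K|X|$. For $\alpha:A\to B$ in $\mathcal F$ with $q(A)=K(\nabla X)$, $q(B)=K'(\nabla Y)$ and $\beta:K|X|\times K(DX)\times K|X|\to K'|Y|\times K'(DY)\times K'|Y|$ with $\beta\circ s^K_X=s^{K'}_Y\circ q(\alpha)$, let $\langle\!\langle\alpha\rangle\!\rangle^\beta:(s^K_X)_!A\to(s^{K'}_Y)_!B$ be the unique arrow above $\beta$ with $\langle\!\langle\alpha\rangle\!\rangle^\beta\circ\mathrm{cc}_{s^K_X,A}=\mathrm{cc}_{s^{K'}_Y,B}\circ\alpha$. For a 1-arrow $F:p\to q$ define $\hat F:\mathrm{Diff}(p)\to\mathrm{Diff}(q)$ by $|\hat FX|=F_b|X|$, $[\hat FX]=F_b(DX)$, $\delta_{\hat FX}=(s^{F_b}_X)_!F_t\delta_X$, and $|\hat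 Ff|=F_b|f|$, $D(\hat Ff)=F_b|f|\times F_b(Df)$, $\overline{\hat Ff}=\langle\!\langle F_t\bar f\rangle\!\rangle^\beta$ with $\beta=F_b|f|\times F_b(Df)\times F_b|f|$. For a 2-arrow $\phi:F\Rightarrow G$ define $\hat\phi:\hat F\Rightarrow\hat G$ by $|\hat\phi_X|=\phi_{b,|X|}$, $D(\hat\phi_X)=\phi_{b,|X|}\times\phi_{b,DX}$, $\overline{\hat\phi_X}=\langle\!\langle\phi_{t,\delta_X}\rangle\!\rangle^\beta$ with $\beta=\phi_{b,|X|}\times\phi_{b,DX}\times\phi_{b,|X|}$. Put $\mathcal D(p)=\partial_p$, $\mathcal D(F)=(F_b,\hat F)$, $\mathcal D(\phi)=(\phi_b,\hat\phi)$. Let $\xi^p:\mathrm{Id}\Rightarrow\widehat{\mathrm{Id}_p}$ be given by $|\xi^p_X|=\mathrm{id}_{|X|}$, $D(\xi^p_X)=\langle\pi_1,\mathrm{id}_{DX}\rangle$, $\overline{\xi^p_X}=\mathrm{cc}_{s^{\mathrm{Id}}_X,\delta_X}$. For 1-arrows $F:p\to q$, $G:q\to r$ in $\mathbf{biFib}_c$ let $\omega^{F,G}:\hat G\hat F\Rightarrow\widehat{GF}$ be given by $|\omega^{F,G}_X|=\mathrm{id}$, $D(\omega^{F,G}_X)=\mathrm{id}_{G_bF_b|X|}\times G_b\pi_2$ (with $\pi_2:F_b|X|\times F_b(DX)\to F_b(DX)$), and $\overline{\omega^{F,G}_X}$ the unique arrow above $\mathrm{id}\times G_b\pi_2\times\mathrm{id}$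 with $\overline{\omega^{F,G}_X}\circ\mathrm{cc}_{s^{G_b}_{\hat FX},G_t\delta_{\hat FX}}\circ G_t(\mathrm{cc}_{s^{F_b}_X,F_t\delta_X})=\mathrm{cc}_{s^{G_bF_b}_X,G_tF_t\delta_X}$. For a monad $\mathbb M=(M,\mu,\eta)$ on $p$ in $\mathbf{biFib}_c$, $\mathcal D(\mathbb M)=(\mathcal D(M),\ \mathcal D(\mu)\cdot(\mathrm{id},\omega^{M,M}),\ \mathcal D(\eta)\cdot(\mathrm{id},\xi^p))$. -}

module Defs where

open import Level using (Level; _⊔_) renaming (suc to lsuc)
open import Data.Product using (Σ; ∃; ∃!; _,_; proj₁; proj₂) renaming (_×_ to _∧_)
open import Relation.Binary.Bundles using (Setoid)
open import Relation.Binary.Structures using (IsEquivalence)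
open import Relation.Binary.PropositionalEquality using (_≡_; refl)
import Relation.Binary.Reasoning.Setoid as SetoidReasoning

private
  variable
    o ℓ e o′ ℓ′ e′ o″ ℓ″ e″ o‴ ℓ‴ e‴ : Level

-- Hom-sets are setoids; objects are compared with _≡_ only. Records are without
-- eta, and defined by copatterns, to keep conversion checking fast.
record Category (o ℓ e : Level) : Set (lsuc (o ⊔ ℓ ⊔ e)) where
  no-eta-equality
  infix  4 _⇒_ _≈_
  infixr 9 _∘_
  field
    Obj       : Set o
    _⇒_       : Obj → Obj → Set ℓ
    _≈_       : ∀ {A B} → A ⇒ B → A ⇒ B → Set e
    id        : ∀ {A} → A ⇒ A
    _∘_       : ∀ {A B C} → B ⇒ C → A ⇒ B → A ⇒ C
    equiv     : ∀ {A B} → IsEquivalence (_≈_ {A} {B})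
    assoc     : ∀ {A B C D} {f : A ⇒ B} {g : B ⇒ C} {h : C ⇒ D} →
                (h ∘ g) ∘ f ≈ h ∘ (g ∘ f)
    identityˡ : ∀ {A B} {f : A ⇒ B} → id ∘ f ≈ f
    identityʳ : ∀ {A B} {f : A ⇒ B} → f ∘ id ≈ f
    ∘-resp-≈  : ∀ {A B C} {f f′ : B ⇒ C} {g g′ : A ⇒ B} →
                f ≈ f′ → g ≈ g′ → f ∘ g ≈ f′ ∘ g′

  module Equiv {A B : Obj} = IsEquivalence (equiv {A} {B})

  hom-setoid : Obj → Obj → Setoid ℓ e
  hom-setoid A B = record { Carrier = A ⇒ B ; _≈_ = _≈_ ; isEquivalence = equiv }

  ∘-resp-≈ˡ : ∀ {A B C} {f f′ : B ⇒ C} {g : A ⇒ B} → f ≈ f′ → f ∘ g ≈ f′ ∘ g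
  ∘-resp-≈ˡ q = ∘-resp-≈ q Equiv.refl

  ∘-resp-≈ʳ : ∀ {A B C} {f : B ⇒ C} {g g′ : A ⇒ B} → g ≈ g′ → f ∘ g ≈ f ∘ g′
  ∘-resp-≈ʳ q = ∘-resp-≈ Equiv.refl q

  sym-assoc : ∀ {A B C D} {f : A ⇒ B} {g : B ⇒ C} {h : C ⇒ D} →
              h ∘ (g ∘ f) ≈ (h ∘ g) ∘ f
  sym-assoc = Equiv.sym assoc

  id-comm : ∀ {A B} {f : A ⇒ B} → id ∘ f ≈ f ∘ id
  id-comm = Equiv.trans identityˡ (Equiv.sym identityʳ)

  -- Strict equality of arrows whose endpoints are not definitionally equal:
  -- the endpoints are identical and, along that identity, the arrows are ≈.
  infix 4 _≈ᴴ_
  data _≈ᴴ_ {A B : Obj} (f : A ⇒ B) : ∀ {C D} → C ⇒ D → Set (ℓ ⊔ e) where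
    hrefl : {g : A ⇒ B} → f ≈ g → f ≈ᴴ g

  ≈ᴴ⇒≈ : ∀ {A B} {f g : A ⇒ B} → f ≈ᴴ g → f ≈ g
  ≈ᴴ⇒≈ (hrefl q) = q

  symᴴ : ∀ {A B C D} {f : A ⇒ B} {g : C ⇒ D} → f ≈ᴴ g → g ≈ᴴ f
  symᴴ (hrefl q) = hrefl (Equiv.sym q)

  transᴴ : ∀ {A B C D E F} {f : A ⇒ B} {g : C ⇒ D} {h : E ⇒ F} →
           f ≈ᴴ g → g ≈ᴴ h → f ≈ᴴ h
  transᴴ (hrefl q) (hrefl r) = hrefl (Equiv.trans q r)

  ∘-resp-≈ᴴ : ∀ {A B C A′ B′ C′} {f : B ⇒ C} {f′ : B′ ⇒ C′} {g : A ⇒ B} {g′ : A′ ⇒ B′} →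
              f ≈ᴴ f′ → g ≈ᴴ g′ → f ∘ g ≈ᴴ f′ ∘ g′
  ∘-resp-≈ᴴ (hrefl q) (hrefl r) = hrefl (∘-resp-≈ q r)

  idᴴ : ∀ {A B} → A ≡ B → id {A} ≈ᴴ id {B}
  idᴴ refl = hrefl Equiv.refl

  domᴴ : ∀ {A B C D} {f : A ⇒ B} {g : C ⇒ D} → f ≈ᴴ g → A ≡ C
  domᴴ (hrefl _) = refl

  codᴴ : ∀ {A B C D} {f : A ⇒ B} {g : C ⇒ D} → f ≈ᴴ g → B ≡ D
  codᴴ (hrefl _) = refl

module ⇒-Reasoning {o ℓ e} (C : Category o ℓ e) {A B : Category.Obj C} =
  SetoidReasoning (Category.hom-setoid C A B)

record Functor (C : Category o ℓ e) (D : Category o′ ℓ′ e′)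
       : Set (o ⊔ ℓ ⊔ e ⊔ o′ ⊔ ℓ′ ⊔ e′) where
  no-eta-equality
  private
    module C = Category C
    module D = Category D
  field
    F₀           : C.Obj → D.Obj
    F₁           : ∀ {A B} → A C.⇒ B → F₀ A D.⇒ F₀ B
    identity     : ∀ {A} → F₁ (C.id {A}) D.≈ D.id
    homomorphism : ∀ {X Y Z} {f : X C.⇒ Y} {g : Y C.⇒ Z} →
                   F₁ (g C.∘ f) D.≈ F₁ g D.∘ F₁ f
    F-resp-≈     : ∀ {A B} {f g : A C.⇒ B} → f C.≈ g → F₁ f D.≈ F₁ g

  F-resp-≈ᴴ : ∀ {A B A′ B′} {f : A C.⇒ B} {g : A′ C.⇒ B′} →
              f C.≈ᴴ g → F₁ f D.≈ᴴ F₁ g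
  F-resp-≈ᴴ (C.hrefl q) = D.hrefl (F-resp-≈ q)

  F-resp-∘ : ∀ {A B B′ Z} {f : A C.⇒ B} {g : B C.⇒ Z} {f′ : A C.⇒ B′} {g′ : B′ C.⇒ Z} →
             g C.∘ f C.≈ g′ C.∘ f′ → F₁ g D.∘ F₁ f D.≈ F₁ g′ D.∘ F₁ f′
  F-resp-∘ q = D.Equiv.trans (D.Equiv.sym homomorphism)
                 (D.Equiv.trans (F-resp-≈ q) homomorphism)

idF : {C : Category o ℓ e} → Functor C C
Functor.F₀           idF = λ A → A
Functor.F₁           idF = λ f → f
Functor.identity     (idF {C = C}) = Category.Equiv.refl C
Functor.homomorphism (idF {C = C}) = Category.Equiv.refl C
Functor.F-resp-≈     idF = λ q → q

infixr 9 _∘F_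
_∘F_ : {C : Category o ℓ e} {D : Category o′ ℓ′ e′} {E : Category o″ ℓ″ e″} →
       Functor D E → Functor C D → Functor C E
Functor.F₀           (G ∘F F) = λ A → Functor.F₀ G (Functor.F₀ F A)
Functor.F₁           (G ∘F F) = λ f → Functor.F₁ G (Functor.F₁ F f)
Functor.identity     (_∘F_ {E = E} G F) = Category.Equiv.trans E
  (Functor.F-resp-≈ G (Functor.identity F)) (Functor.identity G)
Functor.homomorphism (_∘F_ {E = E} G F) = Category.Equiv.trans E
  (Functor.F-resp-≈ G (Functor.homomorphism F)) (Functor.homomorphism G)
Functor.F-resp-≈     (G ∘F F) = λ q → Functor.F-resp-≈ G (Functor.F-resp-≈ F q)

infix 4 _≡F_
record _≡F_ {C : Category o ℓ e} {D : Category o′ ℓ′ e′} (F G : Functor C D)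
       : Set (o ⊔ ℓ ⊔ o′ ⊔ ℓ′ ⊔ e′) where
  no-eta-equality
  private
    module C = Category C
    module D = Category D
    module F = Functor F
    module G = Functor G
  field
    eq₀ : ∀ X → F.F₀ X ≡ G.F₀ X
    eq₁ : ∀ {X Y} (f : X C.⇒ Y) → F.F₁ f D.≈ᴴ G.F₁ f

record NaturalTransformation {C : Category o ℓ e} {D : Category o′ ℓ′ e′}
       (F G : Functor C D) : Set (o ⊔ ℓ ⊔ o′ ⊔ ℓ′ ⊔ e′) where
  no-eta-equality
  private
    module C = Category C
    module D = Category D
    module F = Functor F
    module G = Functor G
  field
    η       : ∀ X → F.F₀ X D.⇒ G.F₀ X
    commute : ∀ {X Y} (f : X C.⇒ Y) → η Y D.∘ F.F₁ f D.≈ G.F₁ f D.∘ η X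

  η-resp-≡ : ∀ {X Y} → X ≡ Y → η X D.≈ᴴ η Y
  η-resp-≡ refl = D.hrefl D.Equiv.refl

idN : {C : Category o ℓ e} {D : Category o′ ℓ′ e′} {F : Functor C D} →
      NaturalTransformation F F
NaturalTransformation.η (idN {D = D}) = λ _ → Category.id D
NaturalTransformation.commute (idN {D = D}) = λ _ → Category.id-comm D

infixr 9 _∘ᵥ_
_∘ᵥ_ : {C : Category o ℓ e} {D : Category o′ ℓ′ e′} {F G H : Functor C D} →
       NaturalTransformation G H → NaturalTransformation F G → NaturalTransformation F H
NaturalTransformation.η (_∘ᵥ_ {D = D} ψ φ) X =
  Category._∘_ D (NaturalTransformation.η ψ X) (NaturalTransformation.η φ X)
NaturalTransformation.commute (_∘ᵥ_ {D = D} {F} {G} {H} ψ φ) {X} {Y} f = begin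
  (ψ.η Y ∘ φ.η Y) ∘ F.F₁ f   ≈⟨ assoc ⟩
  ψ.η Y ∘ φ.η Y ∘ F.F₁ f     ≈⟨ ∘-resp-≈ʳ (φ.commute f) ⟩
  ψ.η Y ∘ G.F₁ f ∘ φ.η X     ≈⟨ sym-assoc ⟩
  (ψ.η Y ∘ G.F₁ f) ∘ φ.η X   ≈⟨ ∘-resp-≈ˡ (ψ.commute f) ⟩
  (H.F₁ f ∘ ψ.η X) ∘ φ.η X   ≈⟨ assoc ⟩
  H.F₁ f ∘ ψ.η X ∘ φ.η X     ∎
  where
  open Category D
  open ⇒-Reasoning D
  module F = Functor F
  module G = Functor G
  module H = Functor H
  module φ = NaturalTransformation φ
  module ψ = NaturalTransformation ψ

record MonadData (C : Category o ℓ e) : Set (o ⊔ ℓ ⊔ e) where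
  field
    T : Functor C C
    μ : NaturalTransformation (T ∘F T) T
    η : NaturalTransformation idF T

record IsMonad {C : Category o ℓ e} (M : MonadData C) : Set (o ⊔ e) where
  no-eta-equality
  open Category C
  open MonadData M
  private
    module T = Functor T
    module μ = NaturalTransformation μ
    module η = NaturalTransformation η
  field
    μ-assoc     : ∀ X → μ.η X ∘ T.F₁ (μ.η X) ≈ μ.η X ∘ μ.η (T.F₀ X)
    μ-identityˡ : ∀ X → μ.η X ∘ T.F₁ (η.η X) ≈ id
    μ-identityʳ : ∀ X → μ.η X ∘ η.η (T.F₀ X) ≈ id

record Monad (C : Category o ℓ e) : Set (o ⊔ ℓ ⊔ e) where
  no-eta-equality
  field
    monadData : MonadData C
    isMonad   : IsMonad monadData
  open MonadData monadData public
  open IsMonad isMonad public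

record FiniteProducts (C : Category o ℓ e) : Set (o ⊔ ℓ ⊔ e) where
  no-eta-equality
  open Category C
  -- Left nesting, so that |X| × [X] × |X| = DX × |X|.
  infixl 7 _×ₒ_ _×₁_
  field
    ⊤        : Obj
    !        : ∀ {A} → A ⇒ ⊤
    !-unique : ∀ {A} (f : A ⇒ ⊤) → ! ≈ f
    _×ₒ_     : Obj → Obj → Obj
    π₁       : ∀ {A B} → A ×ₒ B ⇒ A
    π₂       : ∀ {A B} → A ×ₒ B ⇒ B
    ⟨_,_⟩    : ∀ {A B Z} → Z ⇒ A → Z ⇒ B → Z ⇒ A ×ₒ B
    project₁ : ∀ {A B Z} {f : Z ⇒ A} {g : Z ⇒ B} → π₁ ∘ ⟨ f , g ⟩ ≈ f
    project₂ : ∀ {A B Z} {f : Z ⇒ A} {g : Z ⇒ B} → π₂ ∘ ⟨ f , g ⟩ ≈ g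
    ⟨⟩-unique : ∀ {A B Z} {f : Z ⇒ A} {g : Z ⇒ B} {h : Z ⇒ A ×ₒ B} →
               π₁ ∘ h ≈ f → π₂ ∘ h ≈ g → ⟨ f , g ⟩ ≈ h

  _×₁_ : ∀ {A B A′ B′} → A ⇒ A′ → B ⇒ B′ → A ×ₒ B ⇒ A′ ×ₒ B′
  f ×₁ g = ⟨ f ∘ π₁ , g ∘ π₂ ⟩

  pr₁ : ∀ {A B C} → A ×ₒ B ×ₒ C ⇒ A
  pr₁ = π₁ ∘ π₁

  pr₂ : ∀ {A B C} → A ×ₒ B ×ₒ C ⇒ B
  pr₂ = π₂ ∘ π₁

  pr₃ : ∀ {A B C} → A ×ₒ B ×ₒ C ⇒ C
  pr₃ = π₂

  joint-monic : ∀ {A B Z} {f g : Z ⇒ A ×ₒ B} →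
                π₁ ∘ f ≈ π₁ ∘ g → π₂ ∘ f ≈ π₂ ∘ g → f ≈ g
  joint-monic q r =
    Equiv.trans (Equiv.sym (⟨⟩-unique q r)) (⟨⟩-unique Equiv.refl Equiv.refl)

  ⟨⟩-cong : ∀ {A B Z} {f f′ : Z ⇒ A} {g g′ : Z ⇒ B} →
            f ≈ f′ → g ≈ g′ → ⟨ f , g ⟩ ≈ ⟨ f′ , g′ ⟩
  ⟨⟩-cong q r = ⟨⟩-unique (Equiv.trans project₁ (Equiv.sym q))
                          (Equiv.trans project₂ (Equiv.sym r))

  ⟨⟩∘ : ∀ {A B Y Z} {f : Z ⇒ A} {g : Z ⇒ B} {h : Y ⇒ Z} →
        ⟨ f , g ⟩ ∘ h ≈ ⟨ f ∘ h , g ∘ h ⟩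
  ⟨⟩∘ = Equiv.sym (⟨⟩-unique (Equiv.trans sym-assoc (∘-resp-≈ˡ project₁))
                             (Equiv.trans sym-assoc (∘-resp-≈ˡ project₂)))

  ×₁∘⟨⟩ : ∀ {A B A′ B′ Z} {f : A ⇒ A′} {g : B ⇒ B′} {h : Z ⇒ A} {k : Z ⇒ B} →
          (f ×₁ g) ∘ ⟨ h , k ⟩ ≈ ⟨ f ∘ h , g ∘ k ⟩
  ×₁∘⟨⟩ = Equiv.trans ⟨⟩∘ (⟨⟩-cong (Equiv.trans assoc (∘-resp-≈ʳ project₁))
                                   (Equiv.trans assoc (∘-resp-≈ʳ project₂)))

  ×₁-cong : ∀ {A B A′ B′} {f f′ : A ⇒ A′} {g g′ : B ⇒ B′} →
            f ≈ f′ → g ≈ g′ → f ×₁ g ≈ f′ ×₁ g′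
  ×₁-cong q r = ⟨⟩-cong (∘-resp-≈ˡ q) (∘-resp-≈ˡ r)

  ×₁-id : ∀ {A B} → id {A} ×₁ id {B} ≈ id
  ×₁-id = ⟨⟩-unique (Equiv.sym id-comm) (Equiv.sym id-comm)

  ×₁-∘ : ∀ {A B A′ B′ A″ B″} {f : A ⇒ A′} {g : B ⇒ B′} {f′ : A′ ⇒ A″} {g′ : B′ ⇒ B″} →
         (f′ ×₁ g′) ∘ (f ×₁ g) ≈ (f′ ∘ f) ×₁ (g′ ∘ g)
  ×₁-∘ = Equiv.trans ×₁∘⟨⟩ (⟨⟩-cong sym-assoc sym-assoc)

  -- (a × b) ∘ (f × g) = (f′ × g′) ∘ (c × d), componentwise.
  ×₁-square : ∀ {A B A′ B′ C D C′ D′}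
              {f : A ⇒ A′} {g : B ⇒ B′} {a : A′ ⇒ C′} {b : B′ ⇒ D′}
              {c : A ⇒ C} {d : B ⇒ D} {f′ : C ⇒ C′} {g′ : D ⇒ D′} →
              a ∘ f ≈ f′ ∘ c → b ∘ g ≈ g′ ∘ d →
              (a ×₁ b) ∘ (f ×₁ g) ≈ (f′ ×₁ g′) ∘ (c ×₁ d)
  ×₁-square q r = Equiv.trans ×₁-∘ (Equiv.trans (×₁-cong q r) (Equiv.sym ×₁-∘))

record WeakPullback (C : Category o ℓ e) {X Y Z : Category.Obj C}
       (f : Category._⇒_ C X Z) (g : Category._⇒_ C Y Z) : Set (o ⊔ ℓ ⊔ e) where
  no-eta-equality
  open Category C
  field
    P         : Obj
    p₁        : P ⇒ X
    p₂        : P ⇒ Y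
    commute   : f ∘ p₁ ≈ g ∘ p₂
    universal : ∀ {Q} (h₁ : Q ⇒ X) (h₂ : Q ⇒ Y) → f ∘ h₁ ≈ g ∘ h₂ →
                Σ (Q ⇒ P) λ u → (p₁ ∘ u ≈ h₁) ∧ (p₂ ∘ u ≈ h₂)

WeakPullbacks : Category o ℓ e → Set (o ⊔ ℓ ⊔ e)
WeakPullbacks C = ∀ {X Y Z} (f : X ⇒ Z) (g : Y ⇒ Z) → WeakPullback C f g
  where open Category C

module _ {E : Category o ℓ e} {B : Category o′ ℓ′ e′} (p : Functor E B) where
  private
    module E = Category E
    module B = Category B
    module p = Functor p

  Cartesian : ∀ {X Y} → X E.⇒ Y → Set (o ⊔ ℓ ⊔ e ⊔ ℓ′ ⊔ e′)
  Cartesian {X} {Y} f =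
    ∀ {Z} (g : Z E.⇒ Y) (w : p.F₀ Z B.⇒ p.F₀ X) → p.F₁ f B.∘ w B.≈ p.F₁ g →
    ∃! E._≈_ λ h → (p.F₁ h B.≈ w) ∧ (f E.∘ h E.≈ g)

  Cocartesian : ∀ {X Y} → X E.⇒ Y → Set (o ⊔ ℓ ⊔ e ⊔ ℓ′ ⊔ e′)
  Cocartesian {X} {Y} f =
    ∀ {Z} (g : X E.⇒ Z) (w : p.F₀ Y B.⇒ p.F₀ Z) → w B.∘ p.F₁ f B.≈ p.F₁ g →
    ∃! E._≈_ λ h → (p.F₁ h B.≈ w) ∧ (h E.∘ f E.≈ g)

  -- An arrow f of E is above u when p f ≈ᴴ u, which includes that p sends the
  -- endpoints of f to those of u.
  record CartesianLift {I J} (Y : E.Obj) (u : I B.⇒ J) : Set (o ⊔ ℓ ⊔ e ⊔ ℓ′ ⊔ e′) where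
    no-eta-equality
    field
      obj       : E.Obj
      arr       : obj E.⇒ Y
      above     : p.F₁ arr B.≈ᴴ u
      cartesian : Cartesian arr

  record CocartesianLift {I J} (X : E.Obj) (u : I B.⇒ J) : Set (o ⊔ ℓ ⊔ e ⊔ ℓ′ ⊔ e′) where
    no-eta-equality
    field
      obj         : E.Obj
      arr         : X E.⇒ obj
      above       : p.F₁ arr B.≈ᴴ u
      cocartesian : Cocartesian arr

  -- The universal properties, restated for arrows above given arrows of B.

  cartesian-factor : ∀ {X Y Z I J K} {f : X E.⇒ Y} → Cartesian f →
    {u : I B.⇒ J} → p.F₁ f B.≈ᴴ u → (g : Z E.⇒ Y) {v : K B.⇒ J} → p.F₁ g B.≈ᴴ v →
    (w : K B.⇒ I) → u B.∘ w B.≈ v →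
    Σ (Z E.⇒ X) λ h → (p.F₁ h B.≈ᴴ w) ∧ (f E.∘ h E.≈ g)
  cartesian-factor cart (B.hrefl a) g (B.hrefl b) w q
    with cart g w (B.Equiv.trans (B.∘-resp-≈ˡ a) (B.Equiv.trans q (B.Equiv.sym b)))
  ... | h , (r , s) , _ = h , B.hrefl r , s

  cartesian-unique : ∀ {X Y Z K I} {f : X E.⇒ Y} → Cartesian f →
    {h h′ : Z E.⇒ X} {w w′ : K B.⇒ I} → p.F₁ h B.≈ᴴ w → p.F₁ h′ B.≈ᴴ w′ → w B.≈ w′ →
    f E.∘ h E.≈ f E.∘ h′ → h E.≈ h′
  cartesian-unique {f = f} cart {h} {h′} (B.hrefl a) (B.hrefl b) c q
    with cart (f E.∘ h) (p.F₁ h) (B.Equiv.sym p.homomorphism)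
  ... | _ , _ , unique =
    E.Equiv.trans (E.Equiv.sym (unique (B.Equiv.refl , E.Equiv.refl)))
      (unique ( B.Equiv.trans b (B.Equiv.sym (B.Equiv.trans a c))
              , E.Equiv.sym q))

  cocartesian-factor : ∀ {X Y Z I J K} {f : X E.⇒ Y} → Cocartesian f →
    {u : I B.⇒ J} → p.F₁ f B.≈ᴴ u → (g : X E.⇒ Z) {v : I B.⇒ K} → p.F₁ g B.≈ᴴ v →
    (w : J B.⇒ K) → w B.∘ u B.≈ v →
    Σ (Y E.⇒ Z) λ h → (p.F₁ h B.≈ᴴ w) ∧ (h E.∘ f E.≈ g)
  cocartesian-factor cocart (B.hrefl a) g (B.hrefl b) w q
    with cocart g w (B.Equiv.trans (B.∘-resp-≈ʳ a) (B.Equiv.trans q (B.Equiv.sym b)))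
  ... | h , (r , s) , _ = h , B.hrefl r , s

  cocartesian-unique : ∀ {X Y Z J K} {f : X E.⇒ Y} → Cocartesian f →
    {h h′ : Y E.⇒ Z} {w w′ : J B.⇒ K} → p.F₁ h B.≈ᴴ w → p.F₁ h′ B.≈ᴴ w′ → w B.≈ w′ →
    h E.∘ f E.≈ h′ E.∘ f → h E.≈ h′
  cocartesian-unique {f = f} cocart {h} {h′} (B.hrefl a) (B.hrefl b) c q
    with cocart (h E.∘ f) (p.F₁ h) (B.Equiv.sym p.homomorphism)
  ... | _ , _ , unique =
    E.Equiv.trans (E.Equiv.sym (unique (B.Equiv.refl , E.Equiv.refl)))
      (unique ( B.Equiv.trans b (B.Equiv.sym (B.Equiv.trans a c))
              , E.Equiv.sym q))

  -- ⟨⟨α⟩⟩^β : the unique arrow above β with ⟨⟨α⟩⟩^β ∘ cc = cc ∘ α.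
  record CocartesianMap {X X′ I I′ J J′} {u : I B.⇒ J} {u′ : I′ B.⇒ J′}
         (L : CocartesianLift X u) (L′ : CocartesianLift X′ u′)
         (α : X E.⇒ X′) (β : J B.⇒ J′) : Set (ℓ ⊔ e ⊔ ℓ′ ⊔ e′) where
    no-eta-equality
    field
      arr   : CocartesianLift.obj L E.⇒ CocartesianLift.obj L′
      above : p.F₁ arr B.≈ᴴ β
      comm  : arr E.∘ CocartesianLift.arr L E.≈ CocartesianLift.arr L′ E.∘ α

  cocartesian-map : ∀ {X X′ I I′ J J′} {u : I B.⇒ J} {u′ : I′ B.⇒ J′}
    (L : CocartesianLift X u) (L′ : CocartesianLift X′ u′)
    (α : X E.⇒ X′) {γ : I B.⇒ I′} → p.F₁ α B.≈ᴴ γ →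
    (β : J B.⇒ J′) → β B.∘ u B.≈ u′ B.∘ γ → CocartesianMap L L′ α β
  cocartesian-map L L′ α α-above β square
    with cocartesian-factor (CocartesianLift.cocartesian L) (CocartesianLift.above L)
           (CocartesianLift.arr L′ E.∘ α)
           (B.transᴴ (B.hrefl p.homomorphism)
             (B.∘-resp-≈ᴴ (CocartesianLift.above L′) α-above))
           β square
  ... | h , a , c = record { arr = h ; above = a ; comm = c }

  cocartesian-∘ : ∀ {X Y Z} {f : X E.⇒ Y} {g : Y E.⇒ Z} →
    Cocartesian f → Cocartesian g → Cocartesian (g E.∘ f)
  cocartesian-∘ {f = f} {g} cf cg k w q
    with cf k (w B.∘ p.F₁ g)
           (B.Equiv.trans B.assoc
             (B.Equiv.trans (B.∘-resp-≈ʳ (B.Equiv.sym p.homomorphism)) q))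
  ... | h , (a , b) , h-unique with cg h w (B.Equiv.sym a)
  ... | i , (c , d) , i-unique =
    i , ( c , E.Equiv.trans E.sym-assoc (E.Equiv.trans (E.∘-resp-≈ˡ d) b))
      , λ {y} (r , s) → i-unique
          ( r
          , E.Equiv.sym (h-unique
              ( B.Equiv.trans p.homomorphism (B.∘-resp-≈ˡ r)
              , E.Equiv.trans E.assoc s)))

record Fibration (E : Category o ℓ e) (B : Category o′ ℓ′ e′)
       : Set (o ⊔ ℓ ⊔ e ⊔ o′ ⊔ ℓ′ ⊔ e′) where
  no-eta-equality
  private
    module E = Category E
    module B = Category B
  field
    functor : Functor E B
  open Functor functor public
  field
    cartesianLift : ∀ Y {I} (u : I B.⇒ F₀ Y) → CartesianLift functor Y u

  cartesianLift′ : ∀ {Y I J} → F₀ Y ≡ J → (u : I B.⇒ J) → CartesianLift functor Y u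
  cartesianLift′ {Y} refl u = cartesianLift Y u

record Bifibration (E : Category o ℓ e) (B : Category o′ ℓ′ e′)
       : Set (o ⊔ ℓ ⊔ e ⊔ o′ ⊔ ℓ′ ⊔ e′) where
  no-eta-equality
  private
    module E = Category E
    module B = Category B
  field
    fibration : Fibration E B
  open Fibration fibration public
  field
    cocartesianLift : ∀ X {J} (u : F₀ X B.⇒ J) → CocartesianLift functor X u

  cocartesianLift′ : ∀ {X I J} → F₀ X ≡ I → (u : I B.⇒ J) → CocartesianLift functor X u
  cocartesianLift′ {X} refl u = cocartesianLift X u

record Fib₁ {E : Category o ℓ e} {B : Category o′ ℓ′ e′}
            {F : Category o″ ℓ″ e″} {C : Category o‴ ℓ‴ e‴}
            (p : Fibration E B) (q : Fibration F C)
            : Set (o ⊔ ℓ ⊔ e ⊔ o′ ⊔ ℓ′ ⊔ e′ ⊔ o″ ⊔ ℓ″ ⊔ e″ ⊔ o‴ ⊔ ℓ‴ ⊔ e‴) where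
  no-eta-equality
  field
    base   : Functor B C
    total  : Functor E F
    strict : base ∘F Fibration.functor p ≡F Fibration.functor q ∘F total

record Fib₂ {E : Category o ℓ e} {B : Category o′ ℓ′ e′}
            {F : Category o″ ℓ″ e″} {C : Category o‴ ℓ‴ e‴}
            {p : Fibration E B} {q : Fibration F C} (S T : Fib₁ p q)
            : Set (o ⊔ ℓ ⊔ e ⊔ o′ ⊔ ℓ′ ⊔ e′ ⊔ o″ ⊔ ℓ″ ⊔ e″ ⊔ o‴ ⊔ ℓ‴ ⊔ e‴) where
  no-eta-equality
  private
    module p = Fibration p
    module q = Fibration q
    module S = Fib₁ S
    module T = Fib₁ T
    module C = Category C
  field
    base   : NaturalTransformation S.base T.base
    total  : NaturalTransformation S.total T.total
    strict : ∀ X → NaturalTransformation.η base (p.F₀ X)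
                     C.≈ᴴ q.F₁ (NaturalTransformation.η total X)

id₁ : {E : Category o ℓ e} {B : Category o′ ℓ′ e′} {p : Fibration E B} → Fib₁ p p
Fib₁.base   id₁ = idF
Fib₁.total  id₁ = idF
Fib₁.strict (id₁ {B = B}) = record
  { eq₀ = λ _ → refl
  ; eq₁ = λ _ → Category.hrefl (Category.Equiv.refl B)
  }

infixr 9 _∘₁_
_∘₁_ : ∀ {o⁗ ℓ⁗ e⁗ o⁵ ℓ⁵ e⁵}
       {E : Category o ℓ e} {B : Category o′ ℓ′ e′}
       {F : Category o″ ℓ″ e″} {C : Category o‴ ℓ‴ e‴}
       {G : Category o⁗ ℓ⁗ e⁗} {D : Category o⁵ ℓ⁵ e⁵}
       {p : Fibration E B} {q : Fibration F C} {r : Fibration G D} →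
       Fib₁ q r → Fib₁ p q → Fib₁ p r
Fib₁.base   (T ∘₁ S) = Fib₁.base T ∘F Fib₁.base S
Fib₁.total  (T ∘₁ S) = Fib₁.total T ∘F Fib₁.total S
Fib₁.strict (_∘₁_ {E = E} {D = D} {p = p} {q} {r} T S) = record
  { eq₀ = λ X → D.codᴴ (arrow (Category.id E {X}))
  ; eq₁ = arrow
  }
  where
  module D = Category D
  arrow : ∀ {X Y} (f : Category._⇒_ E X Y) →
          Functor.F₁ (Fib₁.base T ∘F Fib₁.base S) (Fibration.F₁ p f)
            D.≈ᴴ Fibration.F₁ r (Functor.F₁ (Fib₁.total T ∘F Fib₁.total S) f)
  arrow f = D.transᴴ
    (Functor.F-resp-≈ᴴ (Fib₁.base T) (_≡F_.eq₁ (Fib₁.strict S) f))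
    (_≡F_.eq₁ (Fib₁.strict T) (Functor.F₁ (Fib₁.total S) f))

infixr 9 _∘₂_
_∘₂_ : {E : Category o ℓ e} {B : Category o′ ℓ′ e′}
       {F : Category o″ ℓ″ e″} {C : Category o‴ ℓ‴ e‴}
       {p : Fibration E B} {q : Fibration F C} {R S T : Fib₁ p q} →
       Fib₂ S T → Fib₂ R S → Fib₂ R T
Fib₂.base   (ψ ∘₂ φ) = Fib₂.base ψ ∘ᵥ Fib₂.base φ
Fib₂.total  (ψ ∘₂ φ) = Fib₂.total ψ ∘ᵥ Fib₂.total φ
Fib₂.strict (_∘₂_ {C = C} {q = q} ψ φ) = λ X →
  transᴴ (∘-resp-≈ᴴ (Fib₂.strict ψ X) (Fib₂.strict φ X))
         (hrefl (Equiv.sym (Fibration.homomorphism q)))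
  where open Category C

record FibMonadData {E : Category o ℓ e} {B : Category o′ ℓ′ e′} (p : Fibration E B)
       : Set (o ⊔ ℓ ⊔ e ⊔ o′ ⊔ ℓ′ ⊔ e′) where
  no-eta-equality
  field
    T : Fib₁ p p
    μ : Fib₂ (T ∘₁ T) T
    η : Fib₂ id₁ T

  baseData : MonadData B
  baseData = record { T = Fib₁.base T ; μ = Fib₂.base μ ; η = Fib₂.base η }

  totalData : MonadData E
  totalData = record { T = Fib₁.total T ; μ = Fib₂.total μ ; η = Fib₂.total η }

record IsFibMonad {E : Category o ℓ e} {B : Category o′ ℓ′ e′} {p : Fibration E B}
       (M : FibMonadData p) : Set (o ⊔ ℓ ⊔ e ⊔ o′ ⊔ ℓ′ ⊔ e′) where
  no-eta-equality
  open FibMonadData M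
  field
    base-isMonad  : IsMonad baseData
    total-isMonad : IsMonad totalData

  totalMonad : Monad E
  totalMonad = record { monadData = totalData ; isMonad = total-isMonad }

-- That is, T and S, paired with their multiplications and units, form a monad on
-- p in Fib.
record IsLifting {E : Category o ℓ e} {B : Category o′ ℓ′ e′} (p : Fibration E B)
       (T : Monad B) (S : Monad E) : Set (o ⊔ ℓ ⊔ e ⊔ o′ ⊔ ℓ′ ⊔ e′) where
  no-eta-equality
  private
    module p = Fibration p
    module B = Category B
    module T = Monad T
    module S = Monad S
  field
    T-strict : T.T ∘F p.functor ≡F p.functor ∘F S.T
    μ-strict : ∀ X → NaturalTransformation.η T.μ (p.F₀ X)
                       B.≈ᴴ p.F₁ (NaturalTransformation.η S.μ X)
    η-strict : ∀ X → NaturalTransformation.η T.η (p.F₀ X)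
                       B.≈ᴴ p.F₁ (NaturalTransformation.η S.η X)

record BiFibc (E : Category o ℓ e) (B : Category o′ ℓ′ e′)
       : Set (o ⊔ ℓ ⊔ e ⊔ o′ ⊔ ℓ′ ⊔ e′) where
  no-eta-equality
  field
    bifibration : Bifibration E B
    products    : FiniteProducts B
  open Bifibration bifibration public

PreservesCocartesian : {E : Category o ℓ e} {B : Category o′ ℓ′ e′}
  {F : Category o″ ℓ″ e″} {C : Category o‴ ℓ‴ e‴}
  (p : Functor E B) (q : Functor F C) → Functor E F →
  Set (o ⊔ ℓ ⊔ e ⊔ ℓ′ ⊔ e′ ⊔ o″ ⊔ ℓ″ ⊔ e″ ⊔ ℓ‴ ⊔ e‴)
PreservesCocartesian {E = E} p q Ft =
  ∀ {X Y} {f : Category._⇒_ E X Y} → Cocartesian p f → Cocartesian q (Functor.F₁ Ft f)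

record BiFibcMonad {E : Category o ℓ e} {B : Category o′ ℓ′ e′} (p : BiFibc E B)
       : Set (o ⊔ ℓ ⊔ e ⊔ o′ ⊔ ℓ′ ⊔ e′) where
  no-eta-equality
  private
    module p = BiFibc p
  field
    fibMonadData         : FibMonadData p.fibration
    isFibMonad           : IsFibMonad fibMonadData
    preservesCocartesian : PreservesCocartesian p.functor p.functor
                             (Fib₁.total (FibMonadData.T fibMonadData))
  open FibMonadData fibMonadData public

module _ {E : Category o ℓ e} {B : Category o′ ℓ′ e′}
         (p : Fibration E B) (products : FiniteProducts B) where
  private
    module E = Category E
    module B = Category B
    module p = Fibration p
  open FiniteProducts products

  -- pts X = |X|, disp X = [X]
  record DiffObj : Set (o ⊔ o′) where
    no-eta-equality
    field
      pts     : B.Obj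
      disp    : B.Obj
    D : B.Obj
    D = pts ×ₒ disp
    ∇ : B.Obj
    ∇ = pts ×ₒ disp ×ₒ pts
    field
      δ       : E.Obj
      δ-above : p.F₀ δ ≡ ∇

  record DiffHom (X Y : DiffObj) : Set (ℓ ⊔ ℓ′ ⊔ e′) where
    no-eta-equality
    private
      module X = DiffObj X
      module Y = DiffObj Y
    field
      fun     : X.pts B.⇒ Y.pts
      D       : X.D B.⇒ Y.D
      π₁-D    : π₁ B.∘ D B.≈ fun B.∘ π₁
      rel     : X.δ E.⇒ Y.δ
      rel-above : p.F₁ rel B.≈ᴴ D ×₁ fun

  record _≈ᴰ_ {X Y : DiffObj} (f g : DiffHom X Y) : Set (e ⊔ e′) where
    no-eta-equality
    private
      module f = DiffHom f
      module g = DiffHom g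
    field
      fun≈ : f.fun B.≈ g.fun
      D≈   : f.D B.≈ g.D
      rel≈ : f.rel E.≈ g.rel

  idᴰ : ∀ {X} → DiffHom X X
  DiffHom.fun  idᴰ = B.id
  DiffHom.D    idᴰ = B.id
  DiffHom.π₁-D idᴰ = B.Equiv.sym B.id-comm
  DiffHom.rel  idᴰ = E.id
  DiffHom.rel-above (idᴰ {X}) = B.transᴴ (B.hrefl p.identity)
    (B.transᴴ (B.idᴴ (DiffObj.δ-above X)) (B.hrefl (B.Equiv.sym ×₁-id)))

  infixr 9 _∘ᴰ_
  _∘ᴰ_ : ∀ {X Y Z} → DiffHom Y Z → DiffHom X Y → DiffHom X Z
  DiffHom.fun (g ∘ᴰ f) = DiffHom.fun g B.∘ DiffHom.fun f
  DiffHom.D (g ∘ᴰ f) = DiffHom.D g B.∘ DiffHom.D f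
  DiffHom.π₁-D (g ∘ᴰ f) = begin
    π₁ B.∘ DiffHom.D g B.∘ DiffHom.D f        ≈⟨ B.sym-assoc ⟩
    (π₁ B.∘ DiffHom.D g) B.∘ DiffHom.D f      ≈⟨ B.∘-resp-≈ˡ (DiffHom.π₁-D g) ⟩
    (DiffHom.fun g B.∘ π₁) B.∘ DiffHom.D f    ≈⟨ B.assoc ⟩
    DiffHom.fun g B.∘ π₁ B.∘ DiffHom.D f      ≈⟨ B.∘-resp-≈ʳ (DiffHom.π₁-D f) ⟩
    DiffHom.fun g B.∘ DiffHom.fun f B.∘ π₁    ≈⟨ B.sym-assoc ⟩
    (DiffHom.fun g B.∘ DiffHom.fun f) B.∘ π₁  ∎
    where open ⇒-Reasoning B
  DiffHom.rel (g ∘ᴰ f) = DiffHom.rel g E.∘ DiffHom.rel f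
  DiffHom.rel-above (g ∘ᴰ f) = B.transᴴ (B.hrefl p.homomorphism)
    (B.transᴴ (B.∘-resp-≈ᴴ (DiffHom.rel-above g) (DiffHom.rel-above f)) (B.hrefl ×₁-∘))

  ≈ᴰ-equiv : ∀ {X Y} → IsEquivalence (_≈ᴰ_ {X} {Y})
  ≈ᴰ-equiv = record
    { refl = record { fun≈ = B.Equiv.refl ; D≈ = B.Equiv.refl ; rel≈ = E.Equiv.refl }
    ; sym = λ q → record
      { fun≈ = B.Equiv.sym (fun≈ q)
      ; D≈ = B.Equiv.sym (D≈ q)
      ; rel≈ = E.Equiv.sym (rel≈ q)
      }
    ; trans = λ q r → record
      { fun≈ = B.Equiv.trans (fun≈ q) (fun≈ r)
      ; D≈ = B.Equiv.trans (D≈ q) (D≈ r)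
      ; rel≈ = E.Equiv.trans (rel≈ q) (rel≈ r)
      }
    }
    where open _≈ᴰ_

  Diff : Category (o ⊔ o′) (ℓ ⊔ ℓ′ ⊔ e′) (e ⊔ e′)
  Category.Obj Diff = DiffObj
  Category._⇒_ Diff = DiffHom
  Category._≈_ Diff = _≈ᴰ_
  Category.id Diff = idᴰ
  Category._∘_ Diff = _∘ᴰ_
  Category.equiv Diff = ≈ᴰ-equiv
  Category.assoc Diff = record { fun≈ = B.assoc ; D≈ = B.assoc ; rel≈ = E.assoc }
  Category.identityˡ Diff = record { fun≈ = B.identityˡ ; D≈ = B.identityˡ ; rel≈ = E.identityˡ }
  Category.identityʳ Diff = record { fun≈ = B.identityʳ ; D≈ = B.identityʳ ; rel≈ = E.identityʳ }
  Category.∘-resp-≈ Diff = λ q r → record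
    { fun≈ = B.∘-resp-≈ (fun≈ q) (fun≈ r)
    ; D≈ = B.∘-resp-≈ (D≈ q) (D≈ r)
    ; rel≈ = E.∘-resp-≈ (rel≈ q) (rel≈ r)
    }
    where open _≈ᴰ_

  ∂-functor : Functor Diff B
  Functor.F₀ ∂-functor = DiffObj.pts
  Functor.F₁ ∂-functor = DiffHom.fun
  Functor.identity ∂-functor = B.Equiv.refl
  Functor.homomorphism ∂-functor = B.Equiv.refl
  Functor.F-resp-≈ ∂-functor = _≈ᴰ_.fun≈

  -- The lift of u : I → |Y| has displacements [Y] and relation
  -- (u × [Y] × u)^* δ_Y.
  ∂-cartesianLift : ∀ Y {I} (u : I B.⇒ DiffObj.pts Y) → CartesianLift ∂-functor Y u
  ∂-cartesianLift Y {I} u = record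
    { obj = X
    ; arr = arr
    ; above = B.hrefl B.Equiv.refl
    ; cartesian = λ {Z} → cart {Z}
    }
    where
    module Y = DiffObj Y
    module L = CartesianLift (p.cartesianLift′ Y.δ-above ((u ×₁ B.id) ×₁ u))
    X : DiffObj
    X = record { pts = I ; disp = Y.disp ; δ = L.obj ; δ-above = B.domᴴ L.above }
    arr : DiffHom X Y
    arr = record
      { fun = u ; D = u ×₁ B.id ; π₁-D = project₁ ; rel = L.arr ; rel-above = L.above }
    cart : Cartesian ∂-functor arr
    cart {Z} g w q = h , (B.Equiv.refl , record
      { fun≈ = q ; D≈ = D-eq ; rel≈ = proj₂ (proj₂ factor) }) , unique
      where
      module g = DiffHom g
      open ⇒-Reasoning B
      hD : DiffObj.D Z B.⇒ DiffObj.D X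
      hD = ⟨ w B.∘ π₁ , π₂ B.∘ g.D ⟩
      D-eq : (u ×₁ B.id) B.∘ hD B.≈ g.D
      D-eq = begin
        (u ×₁ B.id) B.∘ ⟨ w B.∘ π₁ , π₂ B.∘ g.D ⟩     ≈⟨ ×₁∘⟨⟩ ⟩
        ⟨ u B.∘ w B.∘ π₁ , B.id B.∘ π₂ B.∘ g.D ⟩      ≈⟨ ⟨⟩-unique π₁-eq (B.Equiv.sym B.identityˡ) ⟩
        g.D                                           ∎
        where
        π₁-eq : π₁ B.∘ g.D B.≈ u B.∘ w B.∘ π₁
        π₁-eq = B.Equiv.trans g.π₁-D
                  (B.Equiv.trans (B.∘-resp-≈ˡ (B.Equiv.sym q)) B.assoc)
      factor : Σ (DiffObj.δ Z E.⇒ L.obj) λ h →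
               (p.F₁ h B.≈ᴴ hD ×₁ w) ∧ (L.arr E.∘ h E.≈ g.rel)
      factor = cartesian-factor p.functor L.cartesian L.above g.rel g.rel-above
                 (hD ×₁ w) (B.Equiv.trans ×₁-∘ (×₁-cong D-eq q))
      h : DiffHom Z X
      h = record
        { fun = w ; D = hD ; π₁-D = project₁
        ; rel = proj₁ factor ; rel-above = proj₁ (proj₂ factor) }
      unique : ∀ {k : DiffHom Z X} →
               (DiffHom.fun k B.≈ w) ∧ (Category._≈_ Diff (Category._∘_ Diff arr k) g) →
               h ≈ᴰ k
      unique {k} (a , b) = record
        { fun≈ = B.Equiv.sym a
        ; D≈ = D≈
        ; rel≈ = cartesian-unique p.functor L.cartesian
            (proj₁ (proj₂ factor)) k.rel-above (×₁-cong D≈ (B.Equiv.sym a))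
            (E.Equiv.trans (proj₂ (proj₂ factor)) (E.Equiv.sym b.rel≈))
        }
        where
        module k = DiffHom k
        module b = _≈ᴰ_ b
        D≈ : hD B.≈ k.D
        D≈ = ⟨⟩-unique
          (B.Equiv.trans k.π₁-D (B.∘-resp-≈ˡ a))
          (begin
            π₂ B.∘ k.D                      ≈⟨ B.∘-resp-≈ˡ B.identityˡ ⟨
            (B.id B.∘ π₂) B.∘ k.D           ≈⟨ B.∘-resp-≈ˡ project₂ ⟨
            (π₂ B.∘ (u ×₁ B.id)) B.∘ k.D    ≈⟨ B.assoc ⟩
            π₂ B.∘ (u ×₁ B.id) B.∘ k.D      ≈⟨ B.∘-resp-≈ʳ b.D≈ ⟩
            π₂ B.∘ g.D                      ∎)

  ∂ : Fibration Diff B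
  Fibration.functor ∂ = ∂-functor
  Fibration.cartesianLift ∂ = ∂-cartesianLift

  IsDifferentialExtension : Monad B → Monad Diff →
                            Set (o ⊔ ℓ ⊔ e ⊔ o′ ⊔ ℓ′ ⊔ e′)
  IsDifferentialExtension T S = IsLifting ∂ T S

-- 1-arrows are taken from p to itself: the only ones occurring in 𝒟(M) for a
-- monad M on p are Id, M and M ∘ M. The opaque definitions are opaque only to
-- keep type-checking fast: their types state all that is used of them.

Diffᶜ : {E : Category o ℓ e} {B : Category o′ ℓ′ e′} → BiFibc E B →
        Category (o ⊔ o′) (ℓ ⊔ ℓ′ ⊔ e′) (e ⊔ e′)
Diffᶜ p = Diff (BiFibc.fibration p) (BiFibc.products p)

𝒟₀ : {E : Category o ℓ e} {B : Category o′ ℓ′ e′} (p : BiFibc E B) → Fibration (Diffᶜ p) B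
𝒟₀ p = ∂ (BiFibc.fibration p) (BiFibc.products p)

module Construction {E : Category o ℓ e} {B : Category o′ ℓ′ e′} (p : BiFibc E B) where
  private
    module E = Category E
    module B = Category B
    module p = BiFibc p
    module 𝔻 = Category (Diffᶜ p)
  open FiniteProducts p.products

  Endo : Set (o ⊔ ℓ ⊔ e ⊔ o′ ⊔ ℓ′ ⊔ e′)
  Endo = Fib₁ p.fibration p.fibration

  -- K |X| × K (DX) × K |X|
  ŝ : Functor B B → 𝔻.Obj → B.Obj
  ŝ K X = Functor.F₀ K (DiffObj.pts X) ×ₒ Functor.F₀ K (DiffObj.D X)
            ×ₒ Functor.F₀ K (DiffObj.pts X)

  s : (K : Functor B B) (X : 𝔻.Obj) → Functor.F₀ K (DiffObj.∇ X) B.⇒ ŝ K X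
  s K X = ⟨ ⟨ Functor.F₁ K pr₁ , Functor.F₁ K ⟨ pr₁ , pr₂ ⟩ ⟩ , Functor.F₁ K pr₃ ⟩

  ⟨⟨⟩⟩-cong : ∀ {Z U V W} {f f′ : Z B.⇒ U} {g g′ : Z B.⇒ V} {h h′ : Z B.⇒ W} →
              f B.≈ f′ → g B.≈ g′ → h B.≈ h′ →
              ⟨ ⟨ f , g ⟩ , h ⟩ B.≈ ⟨ ⟨ f′ , g′ ⟩ , h′ ⟩
  ⟨⟨⟩⟩-cong a b c = ⟨⟩-cong (⟨⟩-cong a b) c

  ⟨⟨⟩⟩∘ : ∀ {Y Z U V W} {f : Z B.⇒ U} {g : Z B.⇒ V} {h : Z B.⇒ W} {k : Y B.⇒ Z} →
          ⟨ ⟨ f , g ⟩ , h ⟩ B.∘ k B.≈ ⟨ ⟨ f B.∘ k , g B.∘ k ⟩ , h B.∘ k ⟩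
  ⟨⟨⟩⟩∘ = B.Equiv.trans ⟨⟩∘ (⟨⟩-cong ⟨⟩∘ B.Equiv.refl)

  -- (a × b × c) ∘ ⟨f , g , h⟩ = ⟨f′ , g′ , h′⟩ ∘ k, componentwise.
  ×₁-⟨⟨⟩⟩-square : ∀ {Z Z′ U V W U′ V′ W′}
    {f : Z B.⇒ U} {g : Z B.⇒ V} {h : Z B.⇒ W}
    {f′ : Z′ B.⇒ U′} {g′ : Z′ B.⇒ V′} {h′ : Z′ B.⇒ W′}
    {a : U B.⇒ U′} {b : V B.⇒ V′} {c : W B.⇒ W′} {k : Z B.⇒ Z′} →
    a B.∘ f B.≈ f′ B.∘ k → b B.∘ g B.≈ g′ B.∘ k → c B.∘ h B.≈ h′ B.∘ k →
    (a ×₁ b ×₁ c) B.∘ ⟨ ⟨ f , g ⟩ , h ⟩ B.≈ ⟨ ⟨ f′ , g′ ⟩ , h′ ⟩ B.∘ k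
  ×₁-⟨⟨⟩⟩-square q r t =
    B.Equiv.trans ×₁∘⟨⟩ (B.Equiv.trans (⟨⟩-cong ×₁∘⟨⟩ B.Equiv.refl)
      (B.Equiv.trans (⟨⟨⟩⟩-cong q r t) (B.Equiv.sym ⟨⟨⟩⟩∘)))

  module Hat (S : Endo) where
    private
      Sb = Fib₁.base S
      St = Fib₁.total S
      module Sb = Functor Sb
      module St = Functor St

    Sδ-above : (X : 𝔻.Obj) → p.F₀ (St.F₀ (DiffObj.δ X)) ≡ Sb.F₀ (DiffObj.∇ X)
    Sδ-above X = B.codᴴ (B.transᴴ (B.symᴴ (_≡F_.eq₁ (Fib₁.strict S) E.id))
      (Sb.F-resp-≈ᴴ (B.transᴴ (B.hrefl p.identity) (B.idᴴ (DiffObj.δ-above X)))))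

    -- (s^F_X)_! F_t δ_X
    opaque
      ccLift : (X : 𝔻.Obj) → CocartesianLift p.functor (St.F₀ (DiffObj.δ X)) (s Sb X)
      ccLift X = p.cocartesianLift′ (Sδ-above X) (s Sb X)

    cc : (X : 𝔻.Obj) → St.F₀ (DiffObj.δ X) E.⇒ CocartesianLift.obj (ccLift X)
    cc X = CocartesianLift.arr (ccLift X)

    obj : 𝔻.Obj → 𝔻.Obj
    DiffObj.pts (obj X) = Sb.F₀ (DiffObj.pts X)
    DiffObj.disp (obj X) = Sb.F₀ (DiffObj.D X)
    DiffObj.δ (obj X) = CocartesianLift.obj (ccLift X)
    DiffObj.δ-above (obj X) = B.codᴴ (CocartesianLift.above (ccLift X))

    -- Arrows out of F̂X are determined by precomposing the last component with cc.
    ext : ∀ {X Z} {f g : obj X 𝔻.⇒ Z} →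
          DiffHom.fun f B.≈ DiffHom.fun g → DiffHom.D f B.≈ DiffHom.D g →
          DiffHom.rel f E.∘ cc X E.≈ DiffHom.rel g E.∘ cc X → f 𝔻.≈ g
    ext {X} {f = f} {g} a b c = record
      { fun≈ = a
      ; D≈ = b
      ; rel≈ = cocartesian-unique p.functor (CocartesianLift.cocartesian (ccLift X))
          (DiffHom.rel-above f) (DiffHom.rel-above g) (×₁-cong b a) c
      }

    module _ {X Y : 𝔻.Obj} (f : X 𝔻.⇒ Y) where
      private
        f₀ = DiffHom.fun f
        Df = DiffHom.D f

      Srel-above : p.F₁ (St.F₁ (DiffHom.rel f)) B.≈ᴴ Sb.F₁ (Df ×₁ f₀)
      Srel-above = B.transᴴ (B.symᴴ (_≡F_.eq₁ (Fib₁.strict S) (DiffHom.rel f)))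
                            (Sb.F-resp-≈ᴴ (DiffHom.rel-above f))

      private
        ⟨pr₁,pr₂⟩ : ∀ {U V W} → ⟨ pr₁ , pr₂ ⟩ B.≈ π₁ {U ×ₒ V} {W}
        ⟨pr₁,pr₂⟩ = ⟨⟩-unique B.Equiv.refl B.Equiv.refl

        square₁ : f₀ B.∘ pr₁ B.≈ pr₁ B.∘ (Df ×₁ f₀)
        square₁ = begin
          f₀ B.∘ π₁ B.∘ π₁             ≈⟨ B.sym-assoc ⟩
          (f₀ B.∘ π₁) B.∘ π₁           ≈⟨ B.∘-resp-≈ˡ (DiffHom.π₁-D f) ⟨
          (π₁ B.∘ Df) B.∘ π₁           ≈⟨ B.assoc ⟩
          π₁ B.∘ Df B.∘ π₁             ≈⟨ B.∘-resp-≈ʳ project₁ ⟨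
          π₁ B.∘ π₁ B.∘ (Df ×₁ f₀)     ≈⟨ B.sym-assoc ⟩
          (π₁ B.∘ π₁) B.∘ (Df ×₁ f₀)   ∎
          where open ⇒-Reasoning B

        square₂ : Df B.∘ ⟨ pr₁ , pr₂ ⟩ B.≈ ⟨ pr₁ , pr₂ ⟩ B.∘ (Df ×₁ f₀)
        square₂ = begin
          Df B.∘ ⟨ pr₁ , pr₂ ⟩               ≈⟨ B.∘-resp-≈ʳ ⟨pr₁,pr₂⟩ ⟩
          Df B.∘ π₁                          ≈⟨ project₁ ⟨
          π₁ B.∘ (Df ×₁ f₀)                  ≈⟨ B.∘-resp-≈ˡ ⟨pr₁,pr₂⟩ ⟨
          ⟨ pr₁ , pr₂ ⟩ B.∘ (Df ×₁ f₀)       ∎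
          where open ⇒-Reasoning B

      -- ⟨⟨F_t f̄⟩⟩^β
      opaque
        lift : CocartesianMap p.functor (ccLift X) (ccLift Y) (St.F₁ (DiffHom.rel f))
                 (Sb.F₁ f₀ ×₁ Sb.F₁ Df ×₁ Sb.F₁ f₀)
        lift = cocartesian-map p.functor (ccLift X) (ccLift Y) (St.F₁ (DiffHom.rel f))
          Srel-above (Sb.F₁ f₀ ×₁ Sb.F₁ Df ×₁ Sb.F₁ f₀)
          (×₁-⟨⟨⟩⟩-square (Sb.F-resp-∘ square₁) (Sb.F-resp-∘ square₂)
            (Sb.F-resp-∘ (B.Equiv.sym project₂)))

      hom : obj X 𝔻.⇒ obj Y
      DiffHom.fun hom = Sb.F₁ f₀
      DiffHom.D hom = Sb.F₁ f₀ ×₁ Sb.F₁ Df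
      DiffHom.π₁-D hom = project₁
      DiffHom.rel hom = CocartesianMap.arr lift
      DiffHom.rel-above hom = CocartesianMap.above lift

      hom-comm : DiffHom.rel hom E.∘ cc X E.≈ cc Y E.∘ St.F₁ (DiffHom.rel f)
      hom-comm = CocartesianMap.comm lift

    hom-id : ∀ {X} → hom (𝔻.id {X}) 𝔻.≈ 𝔻.id
    hom-id {X} = ext {X} {obj X} {hom 𝔻.id} {𝔻.id} Sb.identity
      (B.Equiv.trans (×₁-cong Sb.identity Sb.identity) ×₁-id) rel-eq
      where
      rel-eq : DiffHom.rel (hom (𝔻.id {X})) E.∘ cc X E.≈ E.id E.∘ cc X
      rel-eq = begin
        DiffHom.rel (hom (𝔻.id {X})) E.∘ cc X   ≈⟨ hom-comm 𝔻.id ⟩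
        cc X E.∘ St.F₁ E.id                      ≈⟨ E.∘-resp-≈ʳ St.identity ⟩
        cc X E.∘ E.id                            ≈⟨ E.id-comm ⟨
        E.id E.∘ cc X                            ∎
        where open ⇒-Reasoning E

    hom-∘ : ∀ {X Y Z} {f : X 𝔻.⇒ Y} {g : Y 𝔻.⇒ Z} → hom (g 𝔻.∘ f) 𝔻.≈ hom g 𝔻.∘ hom f
    hom-∘ {X} {Y} {Z} {f} {g} = ext {X} Sb.homomorphism
      (B.Equiv.trans (×₁-cong Sb.homomorphism Sb.homomorphism) (B.Equiv.sym ×₁-∘))
      (begin
        DiffHom.rel (hom (g 𝔻.∘ f)) E.∘ cc X       ≈⟨ hom-comm (g 𝔻.∘ f) ⟩
        cc Z E.∘ St.F₁ (ḡ E.∘ f̄)                   ≈⟨ E.∘-resp-≈ʳ St.homomorphism ⟩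
        cc Z E.∘ St.F₁ ḡ E.∘ St.F₁ f̄               ≈⟨ E.sym-assoc ⟩
        (cc Z E.∘ St.F₁ ḡ) E.∘ St.F₁ f̄             ≈⟨ E.∘-resp-≈ˡ (hom-comm g) ⟨
        (ĝ E.∘ cc Y) E.∘ St.F₁ f̄                   ≈⟨ E.assoc ⟩
        ĝ E.∘ cc Y E.∘ St.F₁ f̄                     ≈⟨ E.∘-resp-≈ʳ (hom-comm f) ⟨
        ĝ E.∘ f̂ E.∘ cc X                           ≈⟨ E.sym-assoc ⟩
        (ĝ E.∘ f̂) E.∘ cc X                         ∎)
      where
      open ⇒-Reasoning E
      f̄ = DiffHom.rel f
      ḡ = DiffHom.rel g
      f̂ = DiffHom.rel (hom f)
      ĝ = DiffHom.rel (hom g)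

    hom-resp-≈ : ∀ {X Y} {f g : X 𝔻.⇒ Y} → f 𝔻.≈ g → hom f 𝔻.≈ hom g
    hom-resp-≈ {X} {f = f} {g} r = ext {X}
      (Sb.F-resp-≈ (_≈ᴰ_.fun≈ r))
      (×₁-cong (Sb.F-resp-≈ (_≈ᴰ_.fun≈ r)) (Sb.F-resp-≈ (_≈ᴰ_.D≈ r)))
      (E.Equiv.trans (hom-comm f)
        (E.Equiv.trans (E.∘-resp-≈ʳ (St.F-resp-≈ (_≈ᴰ_.rel≈ r)))
          (E.Equiv.sym (hom-comm g))))

    hat : Functor (Diffᶜ p) (Diffᶜ p)
    Functor.F₀ hat = obj
    Functor.F₁ hat = hom
    Functor.identity hat {X} = hom-id {X}
    Functor.homomorphism hat {X} {Y} {Z} {f} {g} = hom-∘ {X} {Y} {Z} {f} {g}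
    Functor.F-resp-≈ hat {X} {Y} {f} {g} = hom-resp-≈ {X} {Y} {f} {g}

  open Hat

  𝒟₁ : Endo → Fib₁ (𝒟₀ p) (𝒟₀ p)
  Fib₁.base (𝒟₁ S) = Fib₁.base S
  Fib₁.total (𝒟₁ S) = hat S
  Fib₁.strict (𝒟₁ S) = record { eq₀ = λ _ → refl ; eq₁ = λ _ → B.hrefl B.Equiv.refl }

  module Hat₂ {S T : Endo} (φ : Fib₂ S T) where
    private
      module Tt = Functor (Fib₁.total T)
      module St = Functor (Fib₁.total S)
      module φb = NaturalTransformation (Fib₂.base φ)
      module φt = NaturalTransformation (Fib₂.total φ)

    module _ (X : 𝔻.Obj) where
      private
        φ₀ = φb.η (DiffObj.pts X)
        φD = φb.η (DiffObj.D X)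

      -- ⟨⟨φ_{t,δ_X}⟩⟩^β
      opaque
        lift₂ : CocartesianMap p.functor (ccLift S X) (ccLift T X) (φt.η (DiffObj.δ X))
                  (φ₀ ×₁ φD ×₁ φ₀)
        lift₂ = cocartesian-map p.functor (ccLift S X) (ccLift T X) (φt.η (DiffObj.δ X))
          (B.transᴴ (B.symᴴ (Fib₂.strict φ (DiffObj.δ X))) (φb.η-resp-≡ (DiffObj.δ-above X)))
          (φ₀ ×₁ φD ×₁ φ₀)
          (×₁-⟨⟨⟩⟩-square (φb.commute _) (φb.commute _) (φb.commute _))

      hom₂ : obj S X 𝔻.⇒ obj T X
      DiffHom.fun hom₂ = φ₀
      DiffHom.D hom₂ = φ₀ ×₁ φD
      DiffHom.π₁-D hom₂ = project₁
      DiffHom.rel hom₂ = CocartesianMap.arr lift₂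
      DiffHom.rel-above hom₂ = CocartesianMap.above lift₂

      hom₂-comm : DiffHom.rel hom₂ E.∘ cc S X E.≈ cc T X E.∘ φt.η (DiffObj.δ X)
      hom₂-comm = CocartesianMap.comm lift₂

    hom₂-natural : ∀ {X Y} (f : X 𝔻.⇒ Y) → hom₂ Y 𝔻.∘ hom S f 𝔻.≈ hom T f 𝔻.∘ hom₂ X
    hom₂-natural {X} {Y} f = ext S {X} (φb.commute (DiffHom.fun f))
      (×₁-square (φb.commute (DiffHom.fun f)) (φb.commute (DiffHom.D f)))
      (begin
        (φY E.∘ Sf) E.∘ cc S X                          ≈⟨ E.assoc ⟩
        φY E.∘ Sf E.∘ cc S X                            ≈⟨ E.∘-resp-≈ʳ (hom-comm S f) ⟩
        φY E.∘ cc S Y E.∘ St.F₁ f̄                       ≈⟨ E.sym-assoc ⟩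
        (φY E.∘ cc S Y) E.∘ St.F₁ f̄                     ≈⟨ E.∘-resp-≈ˡ (hom₂-comm Y) ⟩
        (cc T Y E.∘ φt.η (DiffObj.δ Y)) E.∘ St.F₁ f̄     ≈⟨ E.assoc ⟩
        cc T Y E.∘ φt.η (DiffObj.δ Y) E.∘ St.F₁ f̄       ≈⟨ E.∘-resp-≈ʳ (φt.commute f̄) ⟩
        cc T Y E.∘ Tt.F₁ f̄ E.∘ φt.η (DiffObj.δ X)       ≈⟨ E.sym-assoc ⟩
        (cc T Y E.∘ Tt.F₁ f̄) E.∘ φt.η (DiffObj.δ X)     ≈⟨ E.∘-resp-≈ˡ (hom-comm T f) ⟨
        (Tf E.∘ cc T X) E.∘ φt.η (DiffObj.δ X)          ≈⟨ E.assoc ⟩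
        Tf E.∘ cc T X E.∘ φt.η (DiffObj.δ X)            ≈⟨ E.∘-resp-≈ʳ (hom₂-comm X) ⟨
        Tf E.∘ φX E.∘ cc S X                            ≈⟨ E.sym-assoc ⟩
        (Tf E.∘ φX) E.∘ cc S X                          ∎)
      where
      open ⇒-Reasoning E
      f̄ = DiffHom.rel f
      Sf = DiffHom.rel (hom S f)
      Tf = DiffHom.rel (hom T f)
      φX = DiffHom.rel (hom₂ X)
      φY = DiffHom.rel (hom₂ Y)

    hat₂ : NaturalTransformation (hat S) (hat T)
    NaturalTransformation.η hat₂ = hom₂
    NaturalTransformation.commute hat₂ = hom₂-natural

  open Hat₂

  𝒟₂ : {S T : Endo} → Fib₂ S T → Fib₂ (𝒟₁ S) (𝒟₁ T)
  Fib₂.base (𝒟₂ φ) = Fib₂.base φ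
  Fib₂.total (𝒟₂ φ) = hat₂ φ
  Fib₂.strict (𝒟₂ φ) = λ _ → B.hrefl B.Equiv.refl

  ξ-hom : (X : 𝔻.Obj) → X 𝔻.⇒ obj id₁ X
  DiffHom.fun (ξ-hom X) = B.id
  DiffHom.D (ξ-hom X) = ⟨ π₁ , B.id ⟩
  DiffHom.π₁-D (ξ-hom X) = B.Equiv.trans project₁ (B.Equiv.sym B.identityˡ)
  DiffHom.rel (ξ-hom X) = cc id₁ X
  DiffHom.rel-above (ξ-hom X) = B.transᴴ (CocartesianLift.above (ccLift id₁ X)) (B.hrefl (begin
    ⟨ ⟨ pr₁ , ⟨ pr₁ , pr₂ ⟩ ⟩ , pr₃ ⟩
      ≈⟨ ⟨⟨⟩⟩-cong B.Equiv.refl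
           (⟨⟩-unique (B.∘-resp-≈ʳ B.identityˡ) (B.∘-resp-≈ʳ B.identityˡ))
           (B.Equiv.sym B.identityˡ) ⟩
    ⟨ ⟨ π₁ B.∘ π₁ , B.id B.∘ π₁ ⟩ , B.id B.∘ π₂ ⟩
      ≈⟨ ⟨⟩-cong ⟨⟩∘ B.Equiv.refl ⟨
    ⟨ π₁ , B.id ⟩ ×₁ B.id ∎))
    where open ⇒-Reasoning B

  ξ-natural : ∀ {X Y} (f : X 𝔻.⇒ Y) → ξ-hom Y 𝔻.∘ f 𝔻.≈ hom id₁ f 𝔻.∘ ξ-hom X
  ξ-natural f = record
    { fun≈ = B.id-comm
    ; D≈ = begin
        ⟨ π₁ , B.id ⟩ B.∘ Df                    ≈⟨ ⟨⟩∘ ⟩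
        ⟨ π₁ B.∘ Df , B.id B.∘ Df ⟩             ≈⟨ ⟨⟩-cong (DiffHom.π₁-D f) B.id-comm ⟩
        ⟨ DiffHom.fun f B.∘ π₁ , Df B.∘ B.id ⟩  ≈⟨ ×₁∘⟨⟩ ⟨
        (DiffHom.fun f ×₁ Df) B.∘ ⟨ π₁ , B.id ⟩ ∎
    ; rel≈ = E.Equiv.sym (hom-comm id₁ f)
    }
    where
    open ⇒-Reasoning B
    Df = DiffHom.D f

  ξ-total : NaturalTransformation idF (hat id₁)
  NaturalTransformation.η ξ-total = ξ-hom
  NaturalTransformation.commute ξ-total = ξ-natural

  -- (id , ξ^p) : Id ⇒ 𝒟(Id)
  ξ : Fib₂ id₁ (𝒟₁ id₁)
  Fib₂.base ξ = idN
  Fib₂.total ξ = ξ-total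
  Fib₂.strict ξ = λ _ → B.hrefl B.Equiv.refl

  module Omega (S T : Endo)
               (T-cocart : PreservesCocartesian p.functor p.functor (Fib₁.total T)) where
    private
      Sb = Fib₁.base S
      Tb = Fib₁.base T
      module Tb = Functor Tb
      module St = Functor (Fib₁.total S)
      module Tt = Functor (Fib₁.total T)
      TS = T ∘₁ S

    module _ (X : 𝔻.Obj) where

      -- cc_{s^{G_b}_{F̂X}, G_t δ_{F̂X}} ∘ G_t cc_{s^{F_b}_X, F_t δ_X}, for F = S, G = T
      cc² : Tt.F₀ (St.F₀ (DiffObj.δ X)) E.⇒ CocartesianLift.obj (ccLift T (obj S X))
      cc² = cc T (obj S X) E.∘ Tt.F₁ (cc S X)

      cc²-cocartesian : Cocartesian p.functor cc²
      cc²-cocartesian = cocartesian-∘ p.functor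
        (T-cocart (CocartesianLift.cocartesian (ccLift S X)))
        (CocartesianLift.cocartesian (ccLift T (obj S X)))

      cc²-above : p.F₁ cc² B.≈ᴴ s Tb (obj S X) B.∘ Tb.F₁ (s Sb X)
      cc²-above = B.transᴴ (B.hrefl p.homomorphism)
        (B.∘-resp-≈ᴴ (CocartesianLift.above (ccLift T (obj S X)))
          (B.transᴴ (B.symᴴ (_≡F_.eq₁ (Fib₁.strict T) (cc S X)))
                    (Tb.F-resp-≈ᴴ (CocartesianLift.above (ccLift S X)))))

      ωD : DiffObj.D (obj T (obj S X)) B.⇒ DiffObj.D (obj TS X)
      ωD = B.id ×₁ Tb.F₁ π₂

      ωβ : ŝ Tb (obj S X) B.⇒ ŝ (Fib₁.base TS) X
      ωβ = ωD ×₁ B.id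

      ω-square : ωβ B.∘ (s Tb (obj S X) B.∘ Tb.F₁ (s Sb X))
                   B.≈ s (Fib₁.base TS) X
      ω-square = begin
        ωβ B.∘ (s Tb (obj S X) B.∘ Ts)
          ≈⟨ B.sym-assoc ⟩
        (ωβ B.∘ s Tb (obj S X)) B.∘ Ts
          ≈⟨ B.∘-resp-≈ˡ (B.Equiv.trans ×₁∘⟨⟩ (⟨⟩-cong ×₁∘⟨⟩ B.identityˡ)) ⟩
        ⟨ ⟨ B.id B.∘ Tb.F₁ pr₁ , Tb.F₁ π₂ B.∘ Tb.F₁ ⟨ pr₁ , pr₂ ⟩ ⟩ , Tb.F₁ pr₃ ⟩ B.∘ Ts
          ≈⟨ B.∘-resp-≈ˡ (⟨⟨⟩⟩-cong B.identityˡ (apply project₂) B.Equiv.refl) ⟩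
        ⟨ ⟨ Tb.F₁ pr₁ , Tb.F₁ pr₂ ⟩ , Tb.F₁ pr₃ ⟩ B.∘ Ts
          ≈⟨ ⟨⟨⟩⟩∘ ⟩
        ⟨ ⟨ Tb.F₁ pr₁ B.∘ Ts , Tb.F₁ pr₂ B.∘ Ts ⟩ , Tb.F₁ pr₃ B.∘ Ts ⟩
          ≈⟨ ⟨⟨⟩⟩-cong
               (apply (B.Equiv.trans B.assoc
                 (B.Equiv.trans (B.∘-resp-≈ʳ project₁) project₁)))
               (apply (B.Equiv.trans B.assoc
                 (B.Equiv.trans (B.∘-resp-≈ʳ project₁) project₂)))
               (apply project₂) ⟩
        s (Fib₁.base TS) X ∎
        where
        open ⇒-Reasoning B
        Ts = Tb.F₁ (s Sb X)
        apply : ∀ {U V W} {f : V B.⇒ W} {g : U B.⇒ V} {h : U B.⇒ W} →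
                f B.∘ g B.≈ h → Tb.F₁ f B.∘ Tb.F₁ g B.≈ Tb.F₁ h
        apply k = B.Equiv.trans (B.Equiv.sym Tb.homomorphism) (Tb.F-resp-≈ k)

      opaque
        ω-factor : Σ (CocartesianLift.obj (ccLift T (obj S X)) E.⇒ CocartesianLift.obj (ccLift TS X))
                   λ h → (p.F₁ h B.≈ᴴ ωβ) ∧ (h E.∘ cc² E.≈ cc TS X)
        ω-factor = cocartesian-factor p.functor cc²-cocartesian cc²-above
          (cc TS X) (CocartesianLift.above (ccLift TS X)) ωβ ω-square

      ω-hom : obj T (obj S X) 𝔻.⇒ obj TS X
      DiffHom.fun ω-hom = B.id
      DiffHom.D ω-hom = ωD
      DiffHom.π₁-D ω-hom = project₁
      DiffHom.rel ω-hom = proj₁ ω-factor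
      DiffHom.rel-above ω-hom = proj₁ (proj₂ ω-factor)

      ω-comm : DiffHom.rel ω-hom E.∘ cc² E.≈ cc TS X
      ω-comm = proj₂ (proj₂ ω-factor)

    ω-natural : ∀ {X Y} (f : X 𝔻.⇒ Y) →
                ω-hom Y 𝔻.∘ hom T (hom S f) 𝔻.≈ hom TS f 𝔻.∘ ω-hom X
    ω-natural {X} {Y} f = record
      { fun≈ = B.id-comm
      ; D≈ = D-eq
      ; rel≈ = cocartesian-unique p.functor (cc²-cocartesian X)
          (DiffHom.rel-above (ω-hom Y 𝔻.∘ hom T (hom S f)))
          (DiffHom.rel-above (hom TS f 𝔻.∘ ω-hom X))
          (×₁-cong D-eq B.id-comm) rel-eq
      }
      where
      open ⇒-Reasoning E
      f̄ = DiffHom.rel f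
      Sf = DiffHom.rel (hom S f)
      TSf = DiffHom.rel (hom T (hom S f))
      TSf′ = DiffHom.rel (hom TS f)
      ωX = DiffHom.rel (ω-hom X)
      ωY = DiffHom.rel (ω-hom Y)
      D-eq : DiffHom.D (ω-hom Y 𝔻.∘ hom T (hom S f)) B.≈ DiffHom.D (hom TS f 𝔻.∘ ω-hom X)
      D-eq = ×₁-square B.id-comm (Tb.F-resp-∘ project₂)
      rel-eq : (ωY E.∘ TSf) E.∘ cc² X E.≈ (TSf′ E.∘ ωX) E.∘ cc² X
      rel-eq = begin
        (ωY E.∘ TSf) E.∘ cc² X
          ≈⟨ E.assoc ⟩
        ωY E.∘ TSf E.∘ cc T (obj S X) E.∘ Tt.F₁ (cc S X)
          ≈⟨ E.∘-resp-≈ʳ (E.Equiv.trans E.sym-assoc (E.∘-resp-≈ˡ (hom-comm T (hom S f)))) ⟩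
        ωY E.∘ (cc T (obj S Y) E.∘ Tt.F₁ Sf) E.∘ Tt.F₁ (cc S X)
          ≈⟨ E.∘-resp-≈ʳ (E.Equiv.trans E.assoc (E.∘-resp-≈ʳ (Tt.F-resp-∘ (hom-comm S f)))) ⟩
        ωY E.∘ cc T (obj S Y) E.∘ Tt.F₁ (cc S Y) E.∘ Tt.F₁ (St.F₁ f̄)
          ≈⟨ E.∘-resp-≈ʳ E.sym-assoc ⟩
        ωY E.∘ cc² Y E.∘ Tt.F₁ (St.F₁ f̄)
          ≈⟨ E.Equiv.trans E.sym-assoc (E.∘-resp-≈ˡ (ω-comm Y)) ⟩
        cc TS Y E.∘ Tt.F₁ (St.F₁ f̄)
          ≈⟨ hom-comm TS f ⟨
        TSf′ E.∘ cc TS X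
          ≈⟨ E.∘-resp-≈ʳ (ω-comm X) ⟨
        TSf′ E.∘ ωX E.∘ cc² X
          ≈⟨ E.sym-assoc ⟩
        (TSf′ E.∘ ωX) E.∘ cc² X ∎

    ω-total : NaturalTransformation (hat T ∘F hat S) (hat TS)
    NaturalTransformation.η ω-total = ω-hom
    NaturalTransformation.commute ω-total = ω-natural

    -- (id , ω^{S,T}) : 𝒟(T) ∘ 𝒟(S) ⇒ 𝒟(T ∘ S)
    ω : Fib₂ (𝒟₁ T ∘₁ 𝒟₁ S) (𝒟₁ TS)
    Fib₂.base ω = idN
    Fib₂.total ω = ω-total
    Fib₂.strict ω = λ _ → B.hrefl B.Equiv.refl

𝒟 : {E : Category o ℓ e} {B : Category o′ ℓ′ e′} {p : BiFibc E B} →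
    BiFibcMonad p → FibMonadData (𝒟₀ p)
FibMonadData.T (𝒟 {p = p} M) = 𝒟₁ p (BiFibcMonad.T M)
  where open Construction
FibMonadData.μ (𝒟 {p = p} M) = 𝒟₂ (BiFibcMonad.μ M) ∘₂
  Omega.ω (BiFibcMonad.T M) (BiFibcMonad.T M) (BiFibcMonad.preservesCocartesian M)
  where open Construction p
FibMonadData.η (𝒟 {p = p} M) = 𝒟₂ (BiFibcMonad.η M) ∘₂ ξ
  where open Construction p

module _ (C : Category o ℓ e) where
  open Category C
  open ⇒-Reasoning C

  infix 4 _≤_ _∼_
  _≤_ : ∀ {I X Y} → X ⇒ I → Y ⇒ I → Set (ℓ ⊔ e)
  α ≤ β = ∃ λ f → α ≈ β ∘ f

  _∼_ : ∀ {I X Y} → X ⇒ I → Y ⇒ I → Set (ℓ ⊔ e)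
  α ∼ β = (α ≤ β) ∧ (β ≤ α)

  -- The class [α] is given by a representative α; two objects (I , α) and
  -- (I , β) denote the same weak subobject when α ∼ β, i.e. when id_I is an
  -- arrow both ways between them. No equation between objects of WS occurs
  -- anywhere, only equations between their images in C.
  record WSObj : Set (o ⊔ ℓ) where
    field
      {cod dom} : Obj
      arr       : dom ⇒ cod

  -- Only `map` is data: _≈_ in WS compares `map` and ignores the witness of ≤.
  record WSHom (A B : WSObj) : Set (ℓ ⊔ e) where
    no-eta-equality
    private
      module A = WSObj A
      module B = WSObj B
    field
      map     : A.cod ⇒ B.cod
      respect : map ∘ A.arr ≤ B.arr

  infixr 9 _∘ᵂ_
  _∘ᵂ_ : ∀ {A B D} → WSHom B D → WSHom A B → WSHom A D
  WSHom.map     (g ∘ᵂ f) = WSHom.map g ∘ WSHom.map f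
  WSHom.respect (_∘ᵂ_ {A} {B} {D} g f) = kg ∘ kf , (begin
    (WSHom.map g ∘ WSHom.map f) ∘ WSObj.arr A   ≈⟨ assoc ⟩
    WSHom.map g ∘ WSHom.map f ∘ WSObj.arr A     ≈⟨ ∘-resp-≈ʳ (proj₂ (WSHom.respect f)) ⟩
    WSHom.map g ∘ WSObj.arr B ∘ kf              ≈⟨ sym-assoc ⟩
    (WSHom.map g ∘ WSObj.arr B) ∘ kf            ≈⟨ ∘-resp-≈ˡ (proj₂ (WSHom.respect g)) ⟩
    (WSObj.arr D ∘ kg) ∘ kf                     ≈⟨ assoc ⟩
    WSObj.arr D ∘ kg ∘ kf                       ∎)
    where
    kg = proj₁ (WSHom.respect g)
    kf = proj₁ (WSHom.respect f)

  WS : Category (o ⊔ ℓ) (ℓ ⊔ e) e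
  Category.Obj WS = WSObj
  Category._⇒_ WS = WSHom
  Category._≈_ WS = λ f g → WSHom.map f ≈ WSHom.map g
  Category.id WS {A} = record { map = id ; respect = id , id-comm }
  Category._∘_ WS = _∘ᵂ_
  Category.equiv WS = record { refl = Equiv.refl ; sym = Equiv.sym ; trans = Equiv.trans }
  Category.assoc WS = assoc
  Category.identityˡ WS = identityˡ
  Category.identityʳ WS = identityʳ
  Category.∘-resp-≈ WS = ∘-resp-≈

  Ψ-functor : Functor WS C
  Functor.F₀ Ψ-functor = WSObj.cod
  Functor.F₁ Ψ-functor = WSHom.map
  Functor.identity Ψ-functor = Equiv.refl
  Functor.homomorphism Ψ-functor = Equiv.refl
  Functor.F-resp-≈ Ψ-functor = λ q → q

  -- u^*(J, [β]) is the weak pullback of β along u.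
  Ψ-cartesianLift : WeakPullbacks C → ∀ B {I} (u : I ⇒ WSObj.cod B) →
                    CartesianLift Ψ-functor B u
  Ψ-cartesianLift wpb B u = record
    { obj = record { arr = P.p₁ }
    ; arr = record { map = u ; respect = P.p₂ , P.commute }
    ; above = hrefl Equiv.refl
    ; cartesian = cartesian
    }
    where
    module P = WeakPullback (wpb u (WSObj.arr B))
    cartesian : Cartesian Ψ-functor {record { arr = P.p₁ }} {B}
                  (record { map = u ; respect = P.p₂ , P.commute })
    cartesian {Z} g w q =
        record { map = w ; respect = proj₁ k , Equiv.sym (proj₁ (proj₂ k)) }
      , (Equiv.refl , q)
      , λ (r , _) → Equiv.sym r
      where
      k = P.universal (w ∘ WSObj.arr Z) (proj₁ (WSHom.respect g))
            (Equiv.trans sym-assoc (Equiv.trans (∘-resp-≈ˡ q) (proj₂ (WSHom.respect g))))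

  -- u_!(I, [α]) = (J, [u ∘ α])
  Ψ-cocartesianLift : ∀ A {J} (u : WSObj.cod A ⇒ J) → CocartesianLift Ψ-functor A u
  Ψ-cocartesianLift A u = record
    { obj = record { arr = u ∘ WSObj.arr A }
    ; arr = record { map = u ; respect = id , Equiv.sym identityʳ }
    ; above = hrefl Equiv.refl
    ; cocartesian = λ g w q →
        record
          { map = w
          ; respect = proj₁ (WSHom.respect g) ,
              Equiv.trans sym-assoc (Equiv.trans (∘-resp-≈ˡ q) (proj₂ (WSHom.respect g)))
          }
        , (Equiv.refl , q)
        , λ (r , _) → Equiv.sym r
    }

  Ψ-fibration : WeakPullbacks C → Fibration WS C
  Fibration.functor (Ψ-fibration wpb) = Ψ-functor
  Fibration.cartesianLift (Ψ-fibration wpb) = Ψ-cartesianLift wpb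

  Ψ-bifibration : WeakPullbacks C → Bifibration WS C
  Bifibration.fibration (Ψ-bifibration wpb) = Ψ-fibration wpb
  Bifibration.cocartesianLift (Ψ-bifibration wpb) = Ψ-cocartesianLift

  Ψ₀ : FiniteProducts C → WeakPullbacks C → BiFibc WS C
  BiFibc.bifibration (Ψ₀ products wpb) = Ψ-bifibration wpb
  BiFibc.products (Ψ₀ products wpb) = products

module _ {C : Category o ℓ e} {C′ : Category o′ ℓ′ e′} where
  private
    module C = Category C
    module C′ = Category C′

  module _ (F : Functor C C′) where
    private module F = Functor F

    F-resp-≤ : ∀ {I X Y} {α : X C.⇒ I} {β : Y C.⇒ I} →
               _≤_ C α β → _≤_ C′ (F.F₁ α) (F.F₁ β)
    F-resp-≤ (f , q) = F.F₁ f , C′.Equiv.trans (F.F-resp-≈ q) F.homomorphism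

    -- F̃ is well defined on classes.
    F-resp-∼ : ∀ {I X Y} {α : X C.⇒ I} {β : Y C.⇒ I} →
               _∼_ C α β → _∼_ C′ (F.F₁ α) (F.F₁ β)
    F-resp-∼ (a , b) = F-resp-≤ a , F-resp-≤ b

    Ψ-total : Functor (WS C) (WS C′)
    Functor.F₀ Ψ-total = λ A → record { arr = F.F₁ (WSObj.arr A) }
    Functor.F₁ Ψ-total = λ f → record
      { map = F.F₁ (WSHom.map f)
      ; respect = F.F₁ (proj₁ (WSHom.respect f)) , F.F-resp-∘ (proj₂ (WSHom.respect f))
      }
    Functor.identity Ψ-total = F.identity
    Functor.homomorphism Ψ-total = F.homomorphism
    Functor.F-resp-≈ Ψ-total = F.F-resp-≈

    -- f : (I,[α]) → (J,[β]) is cocartesian iff β ≤ f ∘ α.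
    Ψ-preservesCocartesian : PreservesCocartesian (Ψ-functor C) (Ψ-functor C′) Ψ-total
    Ψ-preservesCocartesian {A} {B} {f} cocart {Z} g w q
      with cocart (CocartesianLift.arr (Ψ-cocartesianLift C A (WSHom.map f))) C.id C.identityˡ
    ... | h , (a , _) , _ =
      record { map = w ; respect = proj₁ g.respect C′.∘ F.F₁ k , eq }
      , (C′.Equiv.refl , q)
      , λ (r , _) → C′.Equiv.sym r
      where
      module g = WSHom g
      k = proj₁ (WSHom.respect h)
      open ⇒-Reasoning C′
      β≈fαk : WSObj.arr B C.≈ WSHom.map f C.∘ WSObj.arr A C.∘ k
      β≈fαk = C.Equiv.trans (C.Equiv.sym C.identityˡ)
        (C.Equiv.trans (C.∘-resp-≈ˡ (C.Equiv.sym a))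
          (C.Equiv.trans (proj₂ (WSHom.respect h)) C.assoc))
      eq : w C′.∘ F.F₁ (WSObj.arr B)
             C′.≈ WSObj.arr Z C′.∘ proj₁ g.respect C′.∘ F.F₁ k
      eq = begin
        w C′.∘ F.F₁ (WSObj.arr B)
          ≈⟨ C′.∘-resp-≈ʳ (C′.Equiv.trans (F.F-resp-≈ β≈fαk) F.homomorphism) ⟩
        w C′.∘ F.F₁ (WSHom.map f) C′.∘ F.F₁ (WSObj.arr A C.∘ k)
          ≈⟨ C′.Equiv.trans C′.sym-assoc (C′.∘-resp-≈ q F.homomorphism) ⟩
        g.map C′.∘ F.F₁ (WSObj.arr A) C′.∘ F.F₁ k
          ≈⟨ C′.Equiv.trans C′.sym-assoc (C′.∘-resp-≈ˡ (proj₂ g.respect)) ⟩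
        (WSObj.arr Z C′.∘ proj₁ g.respect) C′.∘ F.F₁ k
          ≈⟨ C′.assoc ⟩
        WSObj.arr Z C′.∘ proj₁ g.respect C′.∘ F.F₁ k ∎

    Ψ₁ : (wpb : WeakPullbacks C) (wpb′ : WeakPullbacks C′) →
         Fib₁ (Ψ-fibration C wpb) (Ψ-fibration C′ wpb′)
    Fib₁.base (Ψ₁ wpb wpb′) = F
    Fib₁.total (Ψ₁ wpb wpb′) = Ψ-total
    Fib₁.strict (Ψ₁ wpb wpb′) = record
      { eq₀ = λ _ → refl
      ; eq₁ = λ _ → C′.hrefl C′.Equiv.refl
      }

  Ψ-total₂ : {F G : Functor C C′} → NaturalTransformation F G →
             NaturalTransformation (Ψ-total F) (Ψ-total G)
  NaturalTransformation.η (Ψ-total₂ φ) A = record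
    { map = NaturalTransformation.η φ (WSObj.cod A)
    ; respect = NaturalTransformation.η φ (WSObj.dom A) ,
                NaturalTransformation.commute φ (WSObj.arr A)
    }
  NaturalTransformation.commute (Ψ-total₂ φ) f = NaturalTransformation.commute φ (WSHom.map f)

module _ {C : Category o ℓ e} (products : FiniteProducts C) (wpb : WeakPullbacks C)
         (M : Monad C) where
  open Category C
  private module M = Monad M

  -- Repackaged because Ψ-total (T ∘F T) and Ψ-total T ∘F Ψ-total T agree on values
  -- but are not definitionally the same record, and likewise for idF.
  Ψ-μ-total : NaturalTransformation (Ψ-total M.T ∘F Ψ-total M.T) (Ψ-total M.T)
  NaturalTransformation.η       Ψ-μ-total = NaturalTransformation.η (Ψ-total₂ M.μ)
  NaturalTransformation.commute Ψ-μ-total = NaturalTransformation.commute (Ψ-total₂ M.μ)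

  Ψ-η-total : NaturalTransformation idF (Ψ-total M.T)
  NaturalTransformation.η       Ψ-η-total = NaturalTransformation.η (Ψ-total₂ M.η)
  NaturalTransformation.commute Ψ-η-total = NaturalTransformation.commute (Ψ-total₂ M.η)

  Ψ-μ : Fib₂ (Ψ₁ M.T wpb wpb ∘₁ Ψ₁ M.T wpb wpb) (Ψ₁ M.T wpb wpb)
  Fib₂.base Ψ-μ = M.μ
  Fib₂.total Ψ-μ = Ψ-μ-total
  Fib₂.strict Ψ-μ = λ _ → hrefl Equiv.refl

  Ψ-η : Fib₂ id₁ (Ψ₁ M.T wpb wpb)
  Fib₂.base Ψ-η = M.η
  Fib₂.total Ψ-η = Ψ-η-total
  Fib₂.strict Ψ-η = λ _ → hrefl Equiv.refl

  Ψ-monadData : FibMonadData (Ψ-fibration C wpb)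
  FibMonadData.T Ψ-monadData = Ψ₁ M.T wpb wpb
  FibMonadData.μ Ψ-monadData = Ψ-μ
  FibMonadData.η Ψ-monadData = Ψ-η

  Ψ-isFibMonad : IsFibMonad Ψ-monadData
  Ψ-isFibMonad = record
    { base-isMonad = M.isMonad
    ; total-isMonad = record
      { μ-assoc = λ A → M.μ-assoc (WSObj.cod A)
      ; μ-identityˡ = λ A → M.μ-identityˡ (WSObj.cod A)
      ; μ-identityʳ = λ A → M.μ-identityʳ (WSObj.cod A)
      }
    }

  Ψ : BiFibcMonad (Ψ₀ C products wpb)
  BiFibcMonad.fibMonadData Ψ = Ψ-monadData
  BiFibcMonad.isFibMonad Ψ = Ψ-isFibMonad
  BiFibcMonad.preservesCocartesian Ψ {A} {B} {f} c {Z} =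
    Ψ-preservesCocartesian M.T {A} {B} {f} c {Z}

{-# OPTIONS --safe #-}

-- Ψ_C is faithful, so an arrow of Diff(Ψ_C) is determined by |f| and Df, and the
-- monad laws for 𝒟(Ψ(T)) reduce to identities in C about these two components.
-- Up to ≈ the multiplication has D-component μ_{|X|} × (μ_{DX} ∘ Tπ₂) and the
-- unit has D-component ⟨ η_{|X|} ∘ π₁ , η_{DX} ⟩.
module Submission where

open import Level using (Level; _⊔_)
open import Data.Product using (Σ; _,_)
open import Relation.Binary.PropositionalEquality using (refl)
open import Defs

private
  variable
    o ℓ e o′ ℓ′ e′ : Level

Faithful : {C : Category o ℓ e} {D : Category o′ ℓ′ e′} → Functor C D →
           Set (o ⊔ ℓ ⊔ e ⊔ e′)
Faithful {C = C} {D} F = ∀ {X Y} {f g : Category._⇒_ C X Y} →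
  Category._≈_ D (Functor.F₁ F f) (Functor.F₁ F g) → Category._≈_ C f g

module _ {E : Category o ℓ e} {B : Category o′ ℓ′ e′}
         (p : Fibration E B) (products : FiniteProducts B) where
  open Category B
  open FiniteProducts products

  -- The relation arrows of `f` and `g` lie above the respective `D ×₁ fun`, so agreement of the
  -- first two components identifies their images in the base, and faithfulness reflects this
  -- equality.
  faithful⇒≈ᴰ : Faithful (Fibration.functor p) →
    ∀ {X Y} {f g : DiffHom p products X Y} →
    DiffHom.fun f ≈ DiffHom.fun g → DiffHom.D f ≈ DiffHom.D g → _≈ᴰ_ p products f g
  faithful⇒≈ᴰ faithful {f = f} {g} fun≈ D≈ = record
    { fun≈ = fun≈
    ; D≈ = D≈
    ; rel≈ = faithful (≈ᴴ⇒≈ (transᴴ (DiffHom.rel-above f)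
        (transᴴ (hrefl (×₁-cong D≈ fun≈)) (symᴴ (DiffHom.rel-above g)))))
    }

module _ {E : Category o ℓ e} {B : Category o′ ℓ′ e′} {p : BiFibc E B}
         (faithful : Faithful (BiFibc.functor p)) (M : BiFibcMonad p) where
  private
    module M = BiFibcMonad M
    module T = Functor (Fib₁.base M.T)
    module μ = NaturalTransformation (Fib₂.base M.μ)
    module η = NaturalTransformation (Fib₂.base M.η)
    module 𝕋 = IsMonad (IsFibMonad.base-isMonad M.isFibMonad)
    module 𝔻 = Category (Diffᶜ p)
    module 𝒟M = FibMonadData (𝒟 M)
    module T̂ = Functor (Fib₁.total 𝒟M.T)
    module μ̂ = NaturalTransformation (Fib₂.total 𝒟M.μ)
    module η̂ = NaturalTransformation (Fib₂.total 𝒟M.η)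
  open Category B
  open FiniteProducts (BiFibc.products p)
  open ⇒-Reasoning B

  -- On the base, `ω` and `ξ` are identities, so multiplication and unit become `μ ∘ id` and
  -- `η ∘ id`. Each law is that of `M` once these identities are cancelled.
  𝒟-base-isMonad : IsMonad 𝒟M.baseData
  𝒟-base-isMonad = record
    { μ-assoc = λ X → begin
        (μ.η X ∘ id) ∘ T.F₁ (μ.η X ∘ id)   ≈⟨ ∘-resp-≈ identityʳ (T.F-resp-≈ identityʳ) ⟩
        μ.η X ∘ T.F₁ (μ.η X)               ≈⟨ 𝕋.μ-assoc X ⟩
        μ.η X ∘ μ.η (T.F₀ X)               ≈⟨ ∘-resp-≈ identityʳ identityʳ ⟨
        (μ.η X ∘ id) ∘ μ.η (T.F₀ X) ∘ id   ∎
    ; μ-identityˡ = λ X → Equiv.trans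
        (∘-resp-≈ identityʳ (T.F-resp-≈ identityʳ)) (𝕋.μ-identityˡ X)
    ; μ-identityʳ = λ X → Equiv.trans (∘-resp-≈ identityʳ identityʳ) (𝕋.μ-identityʳ X)
    }

  private
    module b = IsMonad 𝒟-base-isMonad

    -- The factor `T.F₁ π₂` comes from `ω`: it discards the copy of T|X| carried inside the
    -- displacements of `T̂ (T̂ X)`, before `μ` is applied.
    μD : (X : 𝔻.Obj) → T.F₀ (T.F₀ (DiffObj.pts X) ×ₒ T.F₀ (DiffObj.D X)) ⇒ T.F₀ (DiffObj.D X)
    μD X = μ.η (DiffObj.D X) ∘ T.F₁ π₂

    -- The `∘ id` stays in the first factor so that this is literally `fun` of `μ̂.η X` and the base
    -- laws apply to it unchanged.
    μ̂-D : (X : 𝔻.Obj) → DiffHom.D (μ̂.η X) ≈ (μ.η (DiffObj.pts X) ∘ id) ×₁ μD X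
    μ̂-D X = ×₁-∘

    η̂-D : (X : 𝔻.Obj) → DiffHom.D (η̂.η X) ≈ ⟨ η.η (DiffObj.pts X) ∘ π₁ , η.η (DiffObj.D X) ⟩
    η̂-D X = Equiv.trans ×₁∘⟨⟩ (⟨⟩-cong Equiv.refl identityʳ)

    T-apply : ∀ {U V W} {f : V ⇒ W} {g : U ⇒ V} {h : U ⇒ W} →
              f ∘ g ≈ h → T.F₁ f ∘ T.F₁ g ≈ T.F₁ h
    T-apply q = Equiv.trans (Equiv.sym T.homomorphism) (T.F-resp-≈ q)

    π₂-μ̂-D : (X : 𝔻.Obj) → π₂ ∘ DiffHom.D (μ̂.η X) ≈ μD X ∘ π₂
    π₂-μ̂-D X = Equiv.trans (∘-resp-≈ʳ (μ̂-D X)) project₂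

    π₂-η̂-D : (X : 𝔻.Obj) → π₂ ∘ DiffHom.D (η̂.η X) ≈ η.η (DiffObj.D X)
    π₂-η̂-D X = Equiv.trans (∘-resp-≈ʳ (η̂-D X)) project₂

    -- Projecting `DiffHom.D (μ̂.η X)` by `π₂` leaves `μD X ∘ π₂`; what remains is associativity of
    -- `μ` at DX and naturality of `μ` in `π₂`.
    μD-assoc : (X : 𝔻.Obj) → μD X ∘ T.F₁ (DiffHom.D (μ̂.η X)) ≈ μD X ∘ μD (T̂.F₀ X)
    μD-assoc X = begin
      (μ.η D ∘ T.F₁ π₂) ∘ T.F₁ (DiffHom.D (μ̂.η X))
        ≈⟨ assoc ⟩
      μ.η D ∘ T.F₁ π₂ ∘ T.F₁ (DiffHom.D (μ̂.η X))
        ≈⟨ ∘-resp-≈ʳ (T-apply (Equiv.trans (π₂-μ̂-D X) assoc)) ⟩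
      μ.η D ∘ T.F₁ (μ.η D ∘ T.F₁ π₂ ∘ π₂)
        ≈⟨ ∘-resp-≈ʳ (Equiv.trans T.homomorphism (∘-resp-≈ʳ T.homomorphism)) ⟩
      μ.η D ∘ T.F₁ (μ.η D) ∘ T.F₁ (T.F₁ π₂) ∘ T.F₁ π₂
        ≈⟨ Equiv.trans sym-assoc (∘-resp-≈ˡ (𝕋.μ-assoc D)) ⟩
      (μ.η D ∘ μ.η (T.F₀ D)) ∘ T.F₁ (T.F₁ π₂) ∘ T.F₁ π₂
        ≈⟨ Equiv.trans assoc (∘-resp-≈ʳ sym-assoc) ⟩
      μ.η D ∘ (μ.η (T.F₀ D) ∘ T.F₁ (T.F₁ π₂)) ∘ T.F₁ π₂
        -- This `π₂` projects T|X| × T(DX) to T(DX); moving it in front of `μ` creates the left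
        -- factor `μD X`.
        ≈⟨ ∘-resp-≈ʳ (∘-resp-≈ˡ (μ.commute π₂)) ⟩
      μ.η D ∘ (T.F₁ π₂ ∘ μ.η (DiffObj.D (T̂.F₀ X))) ∘ T.F₁ π₂
        ≈⟨ Equiv.trans (∘-resp-≈ʳ assoc) sym-assoc ⟩
      (μ.η D ∘ T.F₁ π₂) ∘ μ.η (DiffObj.D (T̂.F₀ X)) ∘ T.F₁ π₂ ∎
      where D = DiffObj.D X

    μD-identityˡ : (X : 𝔻.Obj) → μD X ∘ T.F₁ (DiffHom.D (η̂.η X)) ≈ id
    μD-identityˡ X = begin
      (μ.η D ∘ T.F₁ π₂) ∘ T.F₁ (DiffHom.D (η̂.η X))   ≈⟨ assoc ⟩
      μ.η D ∘ T.F₁ π₂ ∘ T.F₁ (DiffHom.D (η̂.η X))     ≈⟨ ∘-resp-≈ʳ (T-apply (π₂-η̂-D X)) ⟩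
      μ.η D ∘ T.F₁ (η.η D)                           ≈⟨ 𝕋.μ-identityˡ D ⟩
      id                                             ∎
      where D = DiffObj.D X

    -- A projection remains instead of an identity because `η` is taken at the whole product T|X| ×
    -- T(DX), whose first factor `μD` then forgets.
    μD-identityʳ : (X : 𝔻.Obj) → μD X ∘ η.η (DiffObj.D (T̂.F₀ X)) ≈ π₂
    μD-identityʳ X = begin
      (μ.η D ∘ T.F₁ π₂) ∘ η.η (DiffObj.D (T̂.F₀ X))   ≈⟨ assoc ⟩
      μ.η D ∘ T.F₁ π₂ ∘ η.η (DiffObj.D (T̂.F₀ X))     ≈⟨ ∘-resp-≈ʳ (η.commute π₂) ⟨
      μ.η D ∘ η.η (T.F₀ D) ∘ π₂                      ≈⟨ sym-assoc ⟩
      (μ.η D ∘ η.η (T.F₀ D)) ∘ π₂                    ≈⟨ ∘-resp-≈ˡ (𝕋.μ-identityʳ D) ⟩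
      id ∘ π₂                                        ≈⟨ identityˡ ⟩
      π₂                                             ∎
      where D = DiffObj.D X

    𝒟-μ-assoc : (X : 𝔻.Obj) → μ̂.η X 𝔻.∘ T̂.F₁ (μ̂.η X) 𝔻.≈ μ̂.η X 𝔻.∘ μ̂.η (T̂.F₀ X)
    𝒟-μ-assoc X = faithful⇒≈ᴰ _ _ faithful (b.μ-assoc (DiffObj.pts X)) (begin
      DiffHom.D (μ̂.η X) ∘ DiffHom.D (T̂.F₁ (μ̂.η X))
        ≈⟨ ∘-resp-≈ˡ (μ̂-D X) ⟩
      ((μ.η _ ∘ id) ×₁ μD X) ∘ DiffHom.D (T̂.F₁ (μ̂.η X))
        ≈⟨ ×₁-square (b.μ-assoc (DiffObj.pts X)) (μD-assoc X) ⟩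
      ((μ.η _ ∘ id) ×₁ μD X) ∘ ((μ.η _ ∘ id) ×₁ μD (T̂.F₀ X))
        ≈⟨ ∘-resp-≈ (μ̂-D X) (μ̂-D (T̂.F₀ X)) ⟨
      DiffHom.D (μ̂.η X) ∘ DiffHom.D (μ̂.η (T̂.F₀ X)) ∎)

    𝒟-μ-identityˡ : (X : 𝔻.Obj) → μ̂.η X 𝔻.∘ T̂.F₁ (η̂.η X) 𝔻.≈ 𝔻.id
    𝒟-μ-identityˡ X = faithful⇒≈ᴰ _ _ faithful (b.μ-identityˡ (DiffObj.pts X)) (begin
      DiffHom.D (μ̂.η X) ∘ DiffHom.D (T̂.F₁ (η̂.η X))
        ≈⟨ Equiv.trans (∘-resp-≈ˡ (μ̂-D X)) ×₁-∘ ⟩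
      ((μ.η _ ∘ id) ∘ T.F₁ (η.η _ ∘ id)) ×₁ (μD X ∘ T.F₁ (DiffHom.D (η̂.η X)))
        ≈⟨ ×₁-cong (b.μ-identityˡ (DiffObj.pts X)) (μD-identityˡ X) ⟩
      id ×₁ id
        ≈⟨ ×₁-id ⟩
      id ∎)

    𝒟-μ-identityʳ : (X : 𝔻.Obj) → μ̂.η X 𝔻.∘ η̂.η (T̂.F₀ X) 𝔻.≈ 𝔻.id
    𝒟-μ-identityʳ X = faithful⇒≈ᴰ _ _ faithful (b.μ-identityʳ (DiffObj.pts X)) (begin
      DiffHom.D (μ̂.η X) ∘ DiffHom.D (η̂.η (T̂.F₀ X))
        ≈⟨ Equiv.trans (∘-resp-≈ (μ̂-D X) (η̂-D (T̂.F₀ X))) ×₁∘⟨⟩ ⟩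
      ⟨ (μ.η _ ∘ id) ∘ η.η _ ∘ π₁ , μD X ∘ η.η (DiffObj.D (T̂.F₀ X)) ⟩
        -- The unit is a pairing, not a product of arrows, so both entries are reduced separately:
        -- they become `π₁` and `π₂`, whose pairing is `id`.
        ≈⟨ ⟨⟩-unique (Equiv.trans identityʳ (Equiv.sym μηπ₁))
                     (Equiv.trans identityʳ (Equiv.sym (μD-identityʳ X))) ⟩
      id ∎)
      where
      μηπ₁ : ∀ {A V} → (μ.η A ∘ id) ∘ η.η (T.F₀ A) ∘ π₁ {T.F₀ A} {V} ≈ π₁
      μηπ₁ = Equiv.trans sym-assoc
        (Equiv.trans (∘-resp-≈ˡ (Equiv.trans (∘-resp-≈ˡ identityʳ) (𝕋.μ-identityʳ _))) identityˡ)

  𝒟-isFibMonad : IsFibMonad (𝒟 M)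
  𝒟-isFibMonad = record
    { base-isMonad = 𝒟-base-isMonad
    ; total-isMonad = record
      { μ-assoc = 𝒟-μ-assoc
      ; μ-identityˡ = 𝒟-μ-identityˡ
      ; μ-identityʳ = 𝒟-μ-identityʳ
      }
    }

corollary4p18 : ∀ {o ℓ e : Level} (C : Category o ℓ e) (products : FiniteProducts C) (wpb : WeakPullbacks C) (T : Monad C) →
    Σ (IsFibMonad (𝒟 (Ψ products wpb T))) λ isMonad →
    IsDifferentialExtension (BiFibc.fibration (Ψ₀ C products wpb)) products T (IsFibMonad.totalMonad isMonad)
corollary4p18 C products wpb T =
    -- Equality in `WS` compares only `map`, so faithfulness of `Ψ-functor` is the identity
    -- function.
    𝒟-isFibMonad (λ f≈g → f≈g) (Ψ products wpb T)
  , record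
    { T-strict = record { eq₀ = λ _ → refl ; eq₁ = λ _ → hrefl Equiv.refl }
    -- `fun` of the multiplication is `μ ∘ id`, with `id` from the base of `ω`; likewise `η ∘ id`
    -- below, with `id` from `ξ`.
    ; μ-strict = λ _ → hrefl (Equiv.sym identityʳ)
    ; η-strict = λ _ → hrefl (Equiv.sym identityʳ)
    }
  where open Category C
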